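{- Let $n\ge 5$ and let $\Sigma$ be a bipyramid on $n$ vertices. Then every generic framework $(\Sigma,\mathbf p)$ in $\mathbb R^2$ admits at most $n-4$ congruence classes, i.e. the set of configurations $\mathbf q\in(\mathbb R^2)^n$ such that $(\Sigma,\mathbf q)$ is equivalent to $(\Sigma,\mathbf p)$ splits into at most $n-4$ classes under congruence.
   Context: For a configuration $\mathbf p=(\mathbf p(1),\dots,\mathbf p(n))\in(\mathbb R^2)^n$ and a triple $\sigma=i_1i_2i_3$ with $1\le i_1<i_2<i_3\le n$, let $C(\sigma,\mathbf p)$ be the $3\times 3$ matrix whose $k$-th column is $(1,\mathbf p(i_k))^T$. A framework $(\Sigma,\mathbf p)$ is a pure 2-dimensional simplicial complex $\Sigma$ on vertex set $\{1,\dots,n\}$ together with a configuration $\mathbf p\in(\mathbb R^2)^n$. Two frameworks $(\Sigma,\mathbf p)$, $(\Sigma,\mathbf q)$ are equivalent if $\det C(\sigma,\mathbf p)=\det C(\sigma,\mathbf q)$ for every 2-simplex $\sigma$ of $\Sigma$ (signed areas), and congruent if $\det C(\sigma,\mathbf p)=\det C(\sigma,\mathbf q)$ for every triple $\sigma\subseteq\{1,\dots,n\}$. The congruence classes of $(\Sigma,\mathbf p)$ are the equivalence classes, under congruence, of the set of configurations $\mathbf q$ with $(\Sigma,\mathbf q)$ equivalent to $(\Sigma,\mathbf p)$. A framework is generic if the $2n$ coordinates of $\mathbf p$ are algebraically independent over $\mathbb Q$. The bipyramid on $n$ vertices, $B_{n-2}$, is the pure 2-dimensional simplicial complex on $\{1,\dots,n\}$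 whose 2-simplices are $\{1,i,i+1\}$ and $\{i,i+1,n\}$ for $2\le i\le n-2$, together with $\{1,2,n-1\}$ and $\{2,n-1,n\}$. -}

module Defs where

open import Algebra.Bundles using (CommutativeMonoid)
import Algebra.Properties.CommutativeSemigroup as CommutativeSemigroup
open import Data.Fin.Base as Fin using (Fin; toℕ; fromℕ<)
open import Data.Fin.Patterns using (0F; 1F; 2F)
open import Data.Fin.Properties using (toℕ<n; toℕ-fromℕ<; toℕ-injective)
open import Data.Fin.Subset using (Subset; ⁅_⁆; _∪_; _⊆_; _∈_)
open import Data.Fin.Subset.Properties using (⊆-trans; ⊆-refl; x∈⁅x⁆; x∈⁅y⁆⇒x≡y; x∈p∪q⁺)
open import Data.List.Base using (List; []; _∷_)
open import Data.List.Relation.Unary.Any using (Any)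
open import Data.Nat.Base as ℕ using (ℕ; suc; s≤s; z≤n; _∸_; _⊔_)
import Data.Nat.Properties as ℕ
open import Data.Product.Base using (Σ-syntax; ∃-syntax; _×_; _,_)
open import Data.Rational.Base as ℚ using (ℚ; 0ℚ; 1ℚ; ½; ∣_∣; Positive)
import Data.Rational.Properties as ℚ
open import Data.Sum.Base using (inj₁; inj₂)
import Data.Vec.Functional as V
open V using (Vector)
open import Relation.Binary.PropositionalEquality using (_≡_; _≢_; refl; sym; trans; cong; cong₂; subst; module ≡-Reasoning)
open import Relation.Nullary using (¬_; yes; no)

-- Reals are Cauchy sequences of rationals; there is no quotient, so equality
-- of reals is always _≈_ (difference tending to 0), never _≡_.

IsCauchy : (ℕ → ℚ) → Set
IsCauchy s = ∀ ε → 0ℚ ℚ.< ε →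
  ∃[ N ] (∀ m n → N ℕ.≤ m → N ℕ.≤ n → ∣ s m ℚ.- s n ∣ ℚ.< ε)

record ℝ : Set where
  constructor mkℝ
  field
    seq    : ℕ → ℚ
    cauchy : IsCauchy seq

open ℝ public

infix 4 _≈_

_≈_ : ℝ → ℝ → Set
x ≈ y = ∀ ε → 0ℚ ℚ.< ε →
  ∃[ N ] (∀ n → N ℕ.≤ n → ∣ seq x n ℚ.- seq y n ∣ ℚ.< ε)

half-pos : ∀ {ε} → 0ℚ ℚ.< ε → 0ℚ ℚ.< ½ ℚ.* ε
half-pos {ε} 0<ε =
  subst (ℚ._< ½ ℚ.* ε) (ℚ.*-zeroʳ ½) (ℚ.*-monoʳ-<-pos ½ 0<ε)

half+half : ∀ ε → ½ ℚ.* ε ℚ.+ ½ ℚ.* ε ≡ ε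
half+half ε =
  trans (sym (ℚ.*-distribʳ-+ ε ½ ½)) (ℚ.*-identityˡ ε)

sub-add : ∀ a b → a ≡ (a ℚ.- b) ℚ.+ b
sub-add a b = sym (trans (ℚ.+-assoc a (ℚ.- b) b)
  (trans (cong (a ℚ.+_) (ℚ.+-inverseˡ b)) (ℚ.+-identityʳ a)))

+-diff : ∀ a b c d → (a ℚ.+ b) ℚ.- (c ℚ.+ d) ≡ (a ℚ.- c) ℚ.+ (b ℚ.- d)
+-diff a b c d = trans (cong ((a ℚ.+ b) ℚ.+_) (ℚ.neg-distrib-+ c d))
  (interchange a b (ℚ.- c) (ℚ.- d))
  where
  open CommutativeSemigroup
    (CommutativeMonoid.commutativeSemigroup ℚ.+-0-commutativeMonoid) using (interchange)

*-diff : ∀ a b c d → a ℚ.* b ℚ.- c ℚ.* d ≡ (a ℚ.- c) ℚ.* b ℚ.+ (b ℚ.- d) ℚ.* c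
*-diff a b c d = sym (begin
  (a - c) * b + (b - d) * c
    ≡⟨ cong₂ _+_ (ℚ.*-distribʳ-+ b a (- c)) (ℚ.*-distribʳ-+ c b (- d)) ⟩
  (a * b + (- c) * b) + (b * c + (- d) * c)
    ≡⟨ ℚ.+-assoc (a * b) ((- c) * b) _ ⟩
  a * b + ((- c) * b + (b * c + (- d) * c))
    ≡⟨ cong (a * b +_) (sym (ℚ.+-assoc ((- c) * b) (b * c) _)) ⟩
  a * b + (((- c) * b + b * c) + (- d) * c)
    ≡⟨ cong (λ z → a * b + (z + (- d) * c))
         (trans (cong₂ _+_ (sym (ℚ.neg-distribˡ-* c b)) (ℚ.*-comm b c)) (ℚ.+-inverseˡ (c * b))) ⟩
  a * b + (0ℚ + (- d) * c)
    ≡⟨ cong (a * b +_)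
         (trans (ℚ.+-identityˡ _) (trans (sym (ℚ.neg-distribˡ-* d c)) (cong -_ (ℚ.*-comm d c)))) ⟩
  a * b - c * d ∎)
  where
  open ≡-Reasoning
  open import Data.Rational.Base using (_+_; _-_; _*_; -_)

abstract
  +-cauchy : ∀ x y → IsCauchy (λ n → seq x n ℚ.+ seq y n)
  +-cauchy x y ε 0<ε with cauchy x (½ ℚ.* ε) (half-pos 0<ε) | cauchy y (½ ℚ.* ε) (half-pos 0<ε)
  ... | M , hx | N , hy = M ⊔ N , bound
    where
    open ℚ.≤-Reasoning
    bound : ∀ m n → M ⊔ N ℕ.≤ m → M ⊔ N ℕ.≤ n →
            ∣ (seq x m ℚ.+ seq y m) ℚ.- (seq x n ℚ.+ seq y n) ∣ ℚ.< ε
    bound m n m≥ n≥ = begin-strict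
      ∣ (seq x m ℚ.+ seq y m) ℚ.- (seq x n ℚ.+ seq y n) ∣
        ≡⟨ cong ∣_∣ (+-diff (seq x m) (seq y m) (seq x n) (seq y n)) ⟩
      ∣ (seq x m ℚ.- seq x n) ℚ.+ (seq y m ℚ.- seq y n) ∣
        ≤⟨ ℚ.∣p+q∣≤∣p∣+∣q∣ (seq x m ℚ.- seq x n) (seq y m ℚ.- seq y n) ⟩
      ∣ seq x m ℚ.- seq x n ∣ ℚ.+ ∣ seq y m ℚ.- seq y n ∣
        <⟨ ℚ.+-mono-< (hx m n (ℕ.m⊔n≤o⇒m≤o M N m≥) (ℕ.m⊔n≤o⇒m≤o M N n≥))
                      (hy m n (ℕ.m⊔n≤o⇒n≤o M N m≥) (ℕ.m⊔n≤o⇒n≤o M N n≥)) ⟩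
      ½ ℚ.* ε ℚ.+ ½ ℚ.* ε
        ≡⟨ half+half ε ⟩
      ε ∎

abstract
  neg-cauchy : ∀ x → IsCauchy (λ n → ℚ.- seq x n)
  neg-cauchy x ε 0<ε with cauchy x ε 0<ε
  ... | N , hx = N , λ m n m≥ n≥ →
      subst (ℚ._< ε)
        (trans (sym (ℚ.∣-p∣≡∣p∣ (seq x m ℚ.- seq x n)))
               (cong ∣_∣ (ℚ.neg-distrib-+ (seq x m) (ℚ.- seq x n))))
        (hx m n m≥ n≥)

abstract
  const-cauchy : ∀ q → IsCauchy (λ _ → q)
  const-cauchy q ε 0<ε = 0 , λ _ _ _ _ →
    subst (ℚ._< ε) (sym (cong ∣_∣ (ℚ.+-inverseʳ q))) 0<ε

eventually-bounded : ∀ x → ∃[ B ] (Positive B ×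
  (∃[ N ] (∀ n → N ℕ.≤ n → ∣ seq x n ∣ ℚ.< B)))
eventually-bounded x with cauchy x 1ℚ (ℚ.positive⁻¹ 1ℚ)
... | N , hx = 1ℚ ℚ.+ ∣ seq x N ∣
             , ℚ.pos+nonNeg⇒pos 1ℚ ∣ seq x N ∣ {{ℚ.∣-∣-nonNeg (seq x N)}}
             , N , bound
  where
  open ℚ.≤-Reasoning
  bound : ∀ n → N ℕ.≤ n → ∣ seq x n ∣ ℚ.< 1ℚ ℚ.+ ∣ seq x N ∣
  bound n n≥ = begin-strict
    ∣ seq x n ∣
      ≡⟨ cong ∣_∣ (sub-add (seq x n) (seq x N)) ⟩
    ∣ (seq x n ℚ.- seq x N) ℚ.+ seq x N ∣
      ≤⟨ ℚ.∣p+q∣≤∣p∣+∣q∣ (seq x n ℚ.- seq x N) (seq x N) ⟩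
    ∣ seq x n ℚ.- seq x N ∣ ℚ.+ ∣ seq x N ∣
      <⟨ ℚ.+-monoˡ-< ∣ seq x N ∣ (hx n N n≥ ℕ.≤-refl) ⟩
    1ℚ ℚ.+ ∣ seq x N ∣ ∎

*-mono-abs : ∀ p q {c d} → Positive d → ∣ p ∣ ℚ.< c → ∣ q ∣ ℚ.< d →
             ∣ p ℚ.* q ∣ ℚ.< c ℚ.* d
*-mono-abs p q {c} {d} d>0 p<c q<d = begin-strict
  ∣ p ℚ.* q ∣      ≡⟨ ℚ.∣p*q∣≡∣p∣*∣q∣ p q ⟩
  ∣ p ∣ ℚ.* ∣ q ∣  ≤⟨ ℚ.*-monoˡ-≤-nonNeg ∣ p ∣ {{ℚ.∣-∣-nonNeg p}} (ℚ.<⇒≤ q<d) ⟩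
  ∣ p ∣ ℚ.* d      <⟨ ℚ.*-monoˡ-<-pos d {{d>0}} p<c ⟩
  c ℚ.* d          ∎
  where open ℚ.≤-Reasoning

scale : ∀ ε B → 0ℚ ℚ.< ε → Positive B → ∃[ δ ] (0ℚ ℚ.< δ × δ ℚ.* B ≡ ε)
scale ε B 0<ε B>0 = ε ℚ.* B⁻¹ , ℚ.positive⁻¹ _ {{δ>0}} , eq
  where
  instance
    _ = B>0
    _ = ℚ.pos⇒nonZero B
    _ = ℚ.positive 0<ε
  B⁻¹ = ℚ.1/ B
  δ>0 : Positive (ε ℚ.* B⁻¹)
  δ>0 = ℚ.pos*pos⇒pos ε B⁻¹ {{ℚ.1/pos⇒pos B}}
  eq : ε ℚ.* B⁻¹ ℚ.* B ≡ ε
  eq = trans (ℚ.*-assoc ε B⁻¹ B)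
       (trans (cong (ε ℚ.*_) (ℚ.*-inverseˡ B)) (ℚ.*-identityʳ ε))

abstract
  *-cauchy : ∀ x y → IsCauchy (λ n → seq x n ℚ.* seq y n)
  *-cauchy x y ε 0<ε
    with eventually-bounded x | eventually-bounded y
  ... | A , A>0 , K , hA | B , B>0 , L , hB
    with scale (½ ℚ.* ε) A (half-pos 0<ε) A>0 | scale (½ ℚ.* ε) B (half-pos 0<ε) B>0
  ... | α , 0<α , αA | β , 0<β , βB
    with cauchy x β 0<β | cauchy y α 0<α
  ... | M , hx | N , hy = (K ⊔ L) ⊔ (M ⊔ N) , bound
    where
    open ℚ.≤-Reasoning
    bound : ∀ m n → (K ⊔ L) ⊔ (M ⊔ N) ℕ.≤ m → (K ⊔ L) ⊔ (M ⊔ N) ℕ.≤ n →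
            ∣ seq x m ℚ.* seq y m ℚ.- seq x n ℚ.* seq y n ∣ ℚ.< ε
    bound m n m≥ n≥ = begin-strict
      ∣ seq x m ℚ.* seq y m ℚ.- seq x n ℚ.* seq y n ∣
        ≡⟨ cong ∣_∣ (*-diff (seq x m) (seq y m) (seq x n) (seq y n)) ⟩
      ∣ (seq x m ℚ.- seq x n) ℚ.* seq y m ℚ.+ (seq y m ℚ.- seq y n) ℚ.* seq x n ∣
        ≤⟨ ℚ.∣p+q∣≤∣p∣+∣q∣ ((seq x m ℚ.- seq x n) ℚ.* seq y m) ((seq y m ℚ.- seq y n) ℚ.* seq x n) ⟩
      ∣ (seq x m ℚ.- seq x n) ℚ.* seq y m ∣ ℚ.+ ∣ (seq y m ℚ.- seq y n) ℚ.* seq x n ∣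
        <⟨ ℚ.+-mono-<
             (*-mono-abs (seq x m ℚ.- seq x n) (seq y m) B>0 (hx m n (M≤ m≥) (M≤ n≥)) (hB m (L≤ m≥)))
             (*-mono-abs (seq y m ℚ.- seq y n) (seq x n) A>0 (hy m n (N≤ m≥) (N≤ n≥)) (hA n (K≤ n≥))) ⟩
      β ℚ.* B ℚ.+ α ℚ.* A
        ≡⟨ cong₂ ℚ._+_ βB αA ⟩
      ½ ℚ.* ε ℚ.+ ½ ℚ.* ε
        ≡⟨ half+half ε ⟩
      ε ∎
      where
      K≤ : ∀ {i} → (K ⊔ L) ⊔ (M ⊔ N) ℕ.≤ i → K ℕ.≤ i
      K≤ h = ℕ.m⊔n≤o⇒m≤o K L (ℕ.m⊔n≤o⇒m≤o (K ⊔ L) (M ⊔ N) h)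
      L≤ : ∀ {i} → (K ⊔ L) ⊔ (M ⊔ N) ℕ.≤ i → L ℕ.≤ i
      L≤ h = ℕ.m⊔n≤o⇒n≤o K L (ℕ.m⊔n≤o⇒m≤o (K ⊔ L) (M ⊔ N) h)
      M≤ : ∀ {i} → (K ⊔ L) ⊔ (M ⊔ N) ℕ.≤ i → M ℕ.≤ i
      M≤ h = ℕ.m⊔n≤o⇒m≤o M N (ℕ.m⊔n≤o⇒n≤o (K ⊔ L) (M ⊔ N) h)
      N≤ : ∀ {i} → (K ⊔ L) ⊔ (M ⊔ N) ℕ.≤ i → N ℕ.≤ i
      N≤ h = ℕ.m⊔n≤o⇒n≤o M N (ℕ.m⊔n≤o⇒n≤o (K ⊔ L) (M ⊔ N) h)

infixl 6 _+ᵣ_ _-ᵣ_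
infixl 7 _*ᵣ_
infix  8 -ᵣ_

fromℚ : ℚ → ℝ
fromℚ q = mkℝ (λ _ → q) (const-cauchy q)

0ᵣ 1ᵣ : ℝ
0ᵣ = fromℚ 0ℚ
1ᵣ = fromℚ 1ℚ

_+ᵣ_ _*ᵣ_ : ℝ → ℝ → ℝ
x +ᵣ y = mkℝ (λ n → seq x n ℚ.+ seq y n) (+-cauchy x y)
x *ᵣ y = mkℝ (λ n → seq x n ℚ.* seq y n) (*-cauchy x y)

-ᵣ_ : ℝ → ℝ
-ᵣ x = mkℝ (λ n → ℚ.- seq x n) (neg-cauchy x)

_-ᵣ_ : ℝ → ℝ → ℝ
x -ᵣ y = x +ᵣ -ᵣ y

-- ℚ[X₀,…,X_{k-1}] as iterated univariate polynomials: the list in `poly`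
-- holds the coefficients, in the remaining variables, of X₀⁰, X₀¹, X₀², …
-- Trailing zero coefficients are allowed.
data Poly : ℕ → Set where
  const : ℚ → Poly 0
  poly  : ∀ {k} → List (Poly k) → Poly (suc k)

data NonZeroPoly : ∀ {k} → Poly k → Set where
  const : ∀ {c} → c ≢ 0ℚ → NonZeroPoly (const c)
  poly  : ∀ {k} {cs : List (Poly k)} → Any NonZeroPoly cs → NonZeroPoly (poly cs)

eval   : ∀ {k} → Poly k → Vector ℝ k → ℝ
horner : ∀ {k} → List (Poly k) → Vector ℝ (suc k) → ℝ
eval (const c) x = fromℚ c
eval (poly cs) x = horner cs x
horner []       x = 0ᵣ
horner (c ∷ cs) x = eval c (V.tail x) +ᵣ V.head x *ᵣ horner cs x

AlgebraicallyIndependent : ∀ {k} → Vector ℝ k → Set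
AlgebraicallyIndependent {k} x = (f : Poly k) → NonZeroPoly f → ¬ (eval f x ≈ 0ᵣ)

Config : ℕ → Set
Config n = Vector (Vector ℝ 2) n

Generic : ∀ {n} → Config n → Set
Generic p = AlgebraicallyIndependent (V.concat p)

record Triple (n : ℕ) : Set where
  constructor triple
  field
    i₁ i₂ i₃ : Fin n
    i₁<i₂    : i₁ Fin.< i₂
    i₂<i₃    : i₂ Fin.< i₃

  index : Fin 3 → Fin n
  index 0F = i₁
  index 1F = i₂
  index 2F = i₃

  vertices : Subset n
  vertices = ⁅ i₁ ⁆ ∪ (⁅ i₂ ⁆ ∪ ⁅ i₃ ⁆)

open Triple public

-- Row index first, column index second.
Matrix₃ : Set
Matrix₃ = Fin 3 → Fin 3 → ℝ

det : Matrix₃ → ℝ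
det M = M 0F 0F *ᵣ (M 1F 1F *ᵣ M 2F 2F -ᵣ M 1F 2F *ᵣ M 2F 1F)
     -ᵣ M 0F 1F *ᵣ (M 1F 0F *ᵣ M 2F 2F -ᵣ M 1F 2F *ᵣ M 2F 0F)
     +ᵣ M 0F 2F *ᵣ (M 1F 0F *ᵣ M 2F 1F -ᵣ M 1F 1F *ᵣ M 2F 0F)

C : ∀ {n} → Triple n → Config n → Matrix₃
C σ p r k = (1ᵣ V.∷ p (index σ k)) r

-- By `pure`, every face lies in a 2-simplex; in particular no face has
-- more than three vertices. The empty set counts as a face.
record PureComplex₂ (n : ℕ) : Set₁ where
  field
    Face       : Subset n → Set
    vertex     : ∀ i → Face ⁅ i ⁆
    downClosed : ∀ {s t} → s ⊆ t → Face t → Face s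
    pure       : ∀ {s} → Face s → Σ[ σ ∈ Triple n ] (s ⊆ vertices σ × Face (vertices σ))

open PureComplex₂ public using (Face)

infix 4 _∈₂_

_∈₂_ : ∀ {n} → Triple n → PureComplex₂ n → Set
σ ∈₂ K = Face K (vertices σ)

Equivalent : ∀ {n} → PureComplex₂ n → Config n → Config n → Set
Equivalent K p q = ∀ σ → σ ∈₂ K → det (C σ p) ≈ det (C σ q)

Congruent : ∀ {n} → Config n → Config n → Set
Congruent p q = ∀ σ → det (C σ p) ≈ det (C σ q)

-- The configurations q with (K , q) equivalent to (K , p) split into at most
-- N classes under congruence: any family of such configurations, pairwise in
-- different classes, has at most N members.
AtMostCongruenceClasses : ∀ {n} → ℕ → PureComplex₂ n → Config n → Set
AtMostCongruenceClasses {n} N K p =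
  ∀ {m} (q : Fin m → Config n) →
  (∀ a → Equivalent K p (q a)) →
  (∀ a b → a ≢ b → ¬ Congruent (q a) (q b)) →
  m ℕ.≤ N

-- The vertex called i in {1,…,n} is the element of Fin n with toℕ equal to i ∸ 1.
label : ∀ {n} → Fin n → ℕ
label i = suc (toℕ i)

data BipyramidLabels (n : ℕ) : ℕ → ℕ → ℕ → Set where
  upper      : ∀ {i} → 2 ℕ.≤ i → i ℕ.≤ n ∸ 2 → BipyramidLabels n 1 i (suc i)
  lower      : ∀ {i} → 2 ℕ.≤ i → i ℕ.≤ n ∸ 2 → BipyramidLabels n i (suc i) n
  upperClose : BipyramidLabels n 1 2 (n ∸ 1)
  lowerClose : BipyramidLabels n 2 (n ∸ 1) n

BipyramidTriangle : ∀ {n} → Triple n → Set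
BipyramidTriangle {n} σ = BipyramidLabels n (label (i₁ σ)) (label (i₂ σ)) (label (i₃ σ))

private
  fromLabels : ∀ {n a b c} → 1 ℕ.≤ a → a ℕ.< b → b ℕ.< c → c ℕ.≤ n → BipyramidLabels n a b c →
    Σ[ σ ∈ Triple n ] (BipyramidTriangle σ ×
      label (i₁ σ) ≡ a × label (i₂ σ) ≡ b × label (i₃ σ) ≡ c)
  fromLabels {n} {suc a} {suc b} {suc c} _ (s≤s a<b) (s≤s b<c) c<n t =
    triple (fromℕ< a<n) (fromℕ< b<n) (fromℕ< c<n) lt₁ lt₂ , tri , cong suc ea , cong suc eb , cong suc ec
    where
    b<n : b ℕ.< n
    b<n = ℕ.<-trans b<c c<n
    a<n : a ℕ.< n
    a<n = ℕ.<-trans a<b b<n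
    ea : toℕ (fromℕ< a<n) ≡ a
    ea = toℕ-fromℕ< a<n
    eb : toℕ (fromℕ< b<n) ≡ b
    eb = toℕ-fromℕ< b<n
    ec : toℕ (fromℕ< c<n) ≡ c
    ec = toℕ-fromℕ< c<n
    lt₁ : toℕ (fromℕ< a<n) ℕ.< toℕ (fromℕ< b<n)
    lt₁ rewrite ea | eb = a<b
    lt₂ : toℕ (fromℕ< b<n) ℕ.< toℕ (fromℕ< c<n)
    lt₂ rewrite eb | ec = b<c
    tri : BipyramidLabels n (suc (toℕ (fromℕ< a<n))) (suc (toℕ (fromℕ< b<n))) (suc (toℕ (fromℕ< c<n)))
    tri rewrite ea | eb | ec = t

  singleton⊆ : ∀ {n} {i : Fin n} {s : Subset n} → i ∈ s → ⁅ i ⁆ ⊆ s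
  singleton⊆ {s = s} i∈s j∈ = subst (_∈ s) (sym (x∈⁅y⁆⇒x≡y _ j∈)) i∈s

  label-injective : ∀ {n} {i j : Fin n} → label i ≡ label j → i ≡ j
  label-injective eq = toℕ-injective (ℕ.suc-injective eq)

  i₁∈ : ∀ {n} (σ : Triple n) {i} → label (i₁ σ) ≡ label i → ⁅ i ⁆ ⊆ vertices σ
  i₁∈ σ eq rewrite sym (label-injective eq) =
    singleton⊆ (x∈p∪q⁺ (inj₁ (x∈⁅x⁆ (i₁ σ))))

  i₂∈ : ∀ {n} (σ : Triple n) {i} → label (i₂ σ) ≡ label i → ⁅ i ⁆ ⊆ vertices σ
  i₂∈ σ eq rewrite sym (label-injective eq) =
    singleton⊆ (x∈p∪q⁺ (inj₂ (x∈p∪q⁺ (inj₁ (x∈⁅x⁆ (i₂ σ))))))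

  i₃∈ : ∀ {n} (σ : Triple n) {i} → label (i₃ σ) ≡ label i → ⁅ i ⁆ ⊆ vertices σ
  i₃∈ σ eq rewrite sym (label-injective eq) =
    singleton⊆ (x∈p∪q⁺ (inj₂ (x∈p∪q⁺ (inj₂ (x∈⁅x⁆ (i₃ σ))))))

  bipyramidVertex : ∀ n → 5 ℕ.≤ n → (i : Fin n) →
    Σ[ σ ∈ Triple n ] (BipyramidTriangle σ × ⁅ i ⁆ ⊆ vertices σ)
  bipyramidVertex n@(suc (suc (suc (suc (suc k))))) (s≤s (s≤s (s≤s (s≤s (s≤s _))))) i = go (label i) refl (toℕ<n i)
    where
    2≤2 : 2 ℕ.≤ 2
    2≤2 = ℕ.≤-refl
    2≤n∸2 : 2 ℕ.≤ n ∸ 2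
    2≤n∸2 = s≤s (s≤s z≤n)
    go : ∀ l → label i ≡ l → l ℕ.≤ n →
         Σ[ σ ∈ Triple n ] (BipyramidTriangle σ × ⁅ i ⁆ ⊆ vertices σ)
    go 0 () _
    go 1 eq _ with fromLabels (s≤s z≤n) (s≤s (s≤s z≤n)) ℕ.≤-refl (s≤s (s≤s (s≤s z≤n))) (upper {n} 2≤2 2≤n∸2)
    ... | σ , t , e , _ , _ = σ , t , i₁∈ σ (trans e (sym eq))
    go l@(suc (suc _)) eq l≤n with l ℕ.≤? n ∸ 2
    ... | yes l≤n∸2
        with fromLabels (s≤s z≤n) (s≤s (s≤s z≤n)) ℕ.≤-refl
               (ℕ.≤-trans (s≤s l≤n∸2) (ℕ.n≤1+n _)) (upper {n} (s≤s (s≤s z≤n)) l≤n∸2)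
    ...    | σ , t , _ , e , _ = σ , t , i₂∈ σ (trans e (sym eq))
    go l@(suc (suc _)) eq l≤n | no l≰n∸2 with l ℕ.≟ n
    ... | yes refl
        with fromLabels (s≤s z≤n) ℕ.≤-refl (s≤s (s≤s (s≤s (s≤s z≤n)))) ℕ.≤-refl (lower {n} 2≤2 2≤n∸2)
    ...    | σ , t , _ , _ , e = σ , t , i₃∈ σ (trans e (sym eq))
    go l@(suc (suc _)) eq l≤n | no l≰n∸2 | no l≢n
        with fromLabels (s≤s z≤n) (s≤s (s≤s z≤n)) (s≤s (s≤s (s≤s z≤n))) (ℕ.n≤1+n _) (upperClose {n})
    ...    | σ , t , _ , _ , e = σ , t , i₃∈ σ (trans e (trans (sym l≡n∸1) (sym eq)))
      where
      l≡n∸1 : l ≡ n ∸ 1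
      l≡n∸1 = ℕ.≤-antisym (ℕ.s≤s⁻¹ (ℕ.≤∧≢⇒< l≤n l≢n)) (ℕ.≰⇒> l≰n∸2)

-- The faces are the subsets of the listed triangles, so the 2-simplices are
-- exactly these triangles. This is B_{n-2}.
bipyramid : (n : ℕ) → 5 ℕ.≤ n → PureComplex₂ n
bipyramid n n≥5 = record
  { Face       = λ s → Σ[ σ ∈ Triple n ] (BipyramidTriangle σ × s ⊆ vertices σ)
  ; vertex     = bipyramidVertex n n≥5
  ; downClosed = λ { s⊆t (σ , tri , t⊆σ) → σ , tri , ⊆-trans s⊆t t⊆σ }
  ; pure       = λ { (σ , tri , s⊆σ) → σ , s⊆σ , σ , tri , ⊆-refl }
  }

{-# OPTIONS --safe #-}

-- Write N = 1 and S = n for the apexes, v₀, …, v_{k-1} (k = n - 2) for the equator,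
-- A(i,m) for the signed area of N vᵢ vₘ and zᵢ for that of N S vᵢ. The given areas fix
-- the A(i,i+1) and the differences z_{i+1} - zᵢ, so that t = z₀ is the only unknown and
-- zᵢ = t + Dᵢ with known Dᵢ. Fanning the equator from v₀ with the Plücker relation
-- A(i,j) zₖ + A(j,k) zᵢ = A(i,k) zⱼ gives
--   Σᵢ A(i,i+1) Π_{m ≠ i,i+1} zₘ = 0   (indices mod k),
-- a polynomial equation for t of degree at most k - 2 = n - 4. Its leading coefficient
-- Σᵢ A(i,i+1), the area of the equator, is nonzero for generic p.
--
-- Conversely t fixes all areas, as the Plücker relation yields first the A(1,m), by
-- dividing by zₘ with 1 ≤ m ≤ k - 2, and then all A(i,m), by dividing by z₁. These zₘ do
-- not vanish: if zₘ = 0, the relation for m - 1, m, m + 1 reads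
-- A(m-1,m) (z_{m+1} - zₘ) = A(m,m+1) (zₘ - z_{m-1}), which involves only given areas and
-- fails for generic p.
module Submission where

open import Defs
open import Data.Nat.Base using (ℕ; _≤_; _∸_)
open import Algebra.Bundles using (CommutativeRing)
import Algebra.Solver.Ring as RingSolver
open import Algebra.Solver.Ring.AlmostCommutativeRing using (_-Raw-AlmostCommutative⟶_; fromCommutativeRing)
open import Data.Fin.Base as Fin using (Fin; toℕ; zero; suc; combine; inject≤)
open import Data.Fin.Patterns using (0F; 1F)
open import Data.Fin.Properties using (inject≤-injective; remQuot-combine; toℕ≤pred[n])
open import Data.Fin.Subset.Properties using (⊆-refl)
open import Data.List.Base using (List; []; _∷_)
open import Data.List.Relation.Unary.Any using (here; there)
open import Data.Maybe.Base as Maybe using (Maybe)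
open import Data.Nat.Base as ℕ using (zero; suc; z≤n; s≤s; _<_; _⊔_)
import Data.Nat.Properties as ℕ
open import Data.Product.Base using (Σ-syntax; ∃-syntax; _×_; _,_; proj₁; proj₂)
open import Data.Rational.Base as ℚ using (ℚ; 0ℚ; 1ℚ; ½; ∣_∣)
import Data.Rational.Properties as ℚ
open import Data.Rational.Solver using (module +-*-Solver)
open import Data.Sum.Base using (_⊎_; inj₁; inj₂)
import Data.Vec.Functional as V
open V using (Vector)
open import Level using (0ℓ)
open import Relation.Binary.Bundles using (Setoid)
open import Relation.Binary.PropositionalEquality using (_≡_; _≢_; refl; sym; trans; cong; subst; subst₂)
import Relation.Binary.Reasoning.Setoid as SetoidReasoning
open import Relation.Nullary using (¬_; yes; no; contradiction)
open import Relation.Nullary.Decidable.Core using (dec⇒maybe)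

-- Arithmetic of Cauchy reals

module _ where
  open import Data.Rational.Base using (_+_; _*_; _-_; -_)
  open +-*-Solver

  neg-sub : ∀ a b → - (a - b) ≡ b - a
  neg-sub = solve 2 (λ a b → :- (a :- b) := b :- a) refl

  sub-telescope : ∀ a b c → (a - b) + (b - c) ≡ a - c
  sub-telescope = solve 3 (λ a b c → (a :- b) :+ (b :- c) := a :- c) refl

  sub-distribˡ : ∀ a b c → (b - c) * a ≡ a * b - a * c
  sub-distribˡ = solve 3 (λ a b c → (b :- c) :* a := a :* b :- a :* c) refl

  neg-as-* : ∀ a → - a ≡ (- 1ℚ) * a
  neg-as-* = solve 1 (λ a → :- a := con (- 1ℚ) :* a) refl

∣+∣<ε : ∀ {ε} a b → ∣ a ∣ ℚ.< ½ ℚ.* ε → ∣ b ∣ ℚ.< ½ ℚ.* ε → ∣ a ℚ.+ b ∣ ℚ.< ε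
∣+∣<ε {ε} a b a< b< = begin-strict
  ∣ a ℚ.+ b ∣          ≤⟨ ℚ.∣p+q∣≤∣p∣+∣q∣ a b ⟩
  ∣ a ∣ ℚ.+ ∣ b ∣      <⟨ ℚ.+-mono-< a< b< ⟩
  ½ ℚ.* ε ℚ.+ ½ ℚ.* ε  ≡⟨ half+half ε ⟩
  ε                    ∎
  where open ℚ.≤-Reasoning

infix 4 _≃_

-- A record does not unfold, so unlike _≈_ it lets Agda infer the two reals.
record _≃_ (x y : ℝ) : Set where
  constructor mk≃
  field
    un≃ : x ≈ y

open _≃_

≃-pointwise : ∀ {x y} → (∀ n → seq x n ≡ seq y n) → x ≃ y
≃-pointwise {y = y} eq = mk≃ λ ε 0<ε → 0 , λ n _ → subst (ℚ._< ε)
  (sym (cong ∣_∣ (trans (cong (ℚ._- seq y n) (eq n)) (ℚ.+-inverseʳ (seq y n))))) 0<ε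

≃-refl : ∀ {x} → x ≃ x
≃-refl = ≃-pointwise λ _ → refl

≃-sym : ∀ {x y} → x ≃ y → y ≃ x
≃-sym {x} {y} (mk≃ x≈y) = mk≃ λ ε 0<ε → let N , h = x≈y ε 0<ε in
  N , λ n n≥N → subst (ℚ._< ε)
    (trans (sym (ℚ.∣-p∣≡∣p∣ (seq x n ℚ.- seq y n)))
           (cong ∣_∣ (neg-sub (seq x n) (seq y n))))
    (h n n≥N)

≃-trans : ∀ {x y z} → x ≃ y → y ≃ z → x ≃ z
≃-trans {x} {y} {z} (mk≃ x≈y) (mk≃ y≈z) = mk≃ λ ε 0<ε →
  let M , hx = x≈y (½ ℚ.* ε) (half-pos 0<ε)
      N , hy = y≈z (½ ℚ.* ε) (half-pos 0<ε)
  in M ⊔ N , λ n n≥ → subst (λ d → ∣ d ∣ ℚ.< ε)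
    (sub-telescope (seq x n) (seq y n) (seq z n))
    (∣+∣<ε (seq x n ℚ.- seq y n) (seq y n ℚ.- seq z n)
       (hx n (ℕ.m⊔n≤o⇒m≤o M N n≥)) (hy n (ℕ.m⊔n≤o⇒n≤o M N n≥)))

ℝ-setoid : Setoid 0ℓ 0ℓ
ℝ-setoid = record
  { Carrier = ℝ
  ; _≈_ = _≃_
  ; isEquivalence = record { refl = ≃-refl ; sym = ≃-sym ; trans = ≃-trans }
  }

open SetoidReasoning ℝ-setoid

+ᵣ-cong : ∀ {x x′ y y′} → x ≃ x′ → y ≃ y′ → x +ᵣ y ≃ x′ +ᵣ y′
+ᵣ-cong {x} {x′} {y} {y′} (mk≃ x≈) (mk≃ y≈) = mk≃ λ ε 0<ε →
  let M , hx = x≈ (½ ℚ.* ε) (half-pos 0<ε)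
      N , hy = y≈ (½ ℚ.* ε) (half-pos 0<ε)
  in M ⊔ N , λ n n≥ → subst (λ d → ∣ d ∣ ℚ.< ε)
    (sym (+-diff (seq x n) (seq y n) (seq x′ n) (seq y′ n)))
    (∣+∣<ε (seq x n ℚ.- seq x′ n) (seq y n ℚ.- seq y′ n)
       (hx n (ℕ.m⊔n≤o⇒m≤o M N n≥)) (hy n (ℕ.m⊔n≤o⇒n≤o M N n≥)))

*ᵣ-congˡ : ∀ {x y z} → y ≃ z → x *ᵣ y ≃ x *ᵣ z
*ᵣ-congˡ {x} {y} {z} (mk≃ y≈z) = mk≃ λ ε 0<ε →
  let B , B>0 , K , hB = eventually-bounded x
      δ , 0<δ , δB≡ε   = scale ε B 0<ε B>0
      N , h            = y≈z δ 0<δ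
  in K ⊔ N , λ n n≥ → bound n δB≡ε B>0 (h n (ℕ.m⊔n≤o⇒n≤o K N n≥)) (hB n (ℕ.m⊔n≤o⇒m≤o K N n≥))
  where
  bound : ∀ {δ B ε} n → δ ℚ.* B ≡ ε → ℚ.Positive B → ∣ seq y n ℚ.- seq z n ∣ ℚ.< δ → ∣ seq x n ∣ ℚ.< B →
          ∣ seq x n ℚ.* seq y n ℚ.- seq x n ℚ.* seq z n ∣ ℚ.< ε
  bound n refl B>0 d<δ x<B = subst (λ d → ∣ d ∣ ℚ.< _)
    (sub-distribˡ (seq x n) (seq y n) (seq z n))
    (*-mono-abs (seq y n ℚ.- seq z n) (seq x n) B>0 d<δ x<B)

*ᵣ-comm : ∀ x y → x *ᵣ y ≃ y *ᵣ x
*ᵣ-comm x y = ≃-pointwise λ n → ℚ.*-comm (seq x n) (seq y n)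

*ᵣ-cong : ∀ {x x′ y y′} → x ≃ x′ → y ≃ y′ → x *ᵣ y ≃ x′ *ᵣ y′
*ᵣ-cong {x} {x′} {y} {y′} x≃ y≃ = begin
  x *ᵣ y    ≈⟨ *ᵣ-congˡ y≃ ⟩
  x *ᵣ y′   ≈⟨ *ᵣ-comm x y′ ⟩
  y′ *ᵣ x   ≈⟨ *ᵣ-congˡ x≃ ⟩
  y′ *ᵣ x′  ≈⟨ *ᵣ-comm y′ x′ ⟩
  x′ *ᵣ y′  ∎

-ᵣ-cong : ∀ {x y} → x ≃ y → -ᵣ x ≃ -ᵣ y
-ᵣ-cong {x} {y} x≃y = begin
  -ᵣ x                 ≈⟨ neg x ⟩
  fromℚ (ℚ.- 1ℚ) *ᵣ x  ≈⟨ *ᵣ-congˡ x≃y ⟩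
  fromℚ (ℚ.- 1ℚ) *ᵣ y  ≈⟨ ≃-sym (neg y) ⟩
  -ᵣ y                 ∎
  where
  neg : ∀ x → -ᵣ x ≃ fromℚ (ℚ.- 1ℚ) *ᵣ x
  neg x = ≃-pointwise λ n → neg-as-* (seq x n)

sub-cong : ∀ {x x′ y y′} → x ≃ x′ → y ≃ y′ → x -ᵣ y ≃ x′ -ᵣ y′
sub-cong x≃ y≃ = +ᵣ-cong x≃ (-ᵣ-cong y≃)

ℝ-commutativeRing : CommutativeRing 0ℓ 0ℓ
ℝ-commutativeRing = record
  { Carrier = ℝ
  ; _≈_ = _≃_
  ; _+_ = _+ᵣ_
  ; _*_ = _*ᵣ_
  ; -_ = -ᵣ_
  ; 0# = 0ᵣ
  ; 1# = 1ᵣ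
  ; isCommutativeRing = record
    { isRing = record
      { +-isAbelianGroup = record
        { isGroup = record
          { isMonoid = record
            { isSemigroup = record
              { isMagma = record { isEquivalence = Setoid.isEquivalence ℝ-setoid ; ∙-cong = +ᵣ-cong }
              ; assoc = λ x y z → ≃-pointwise λ n → ℚ.+-assoc (seq x n) (seq y n) (seq z n)
              }
            ; identity = (λ x → ≃-pointwise λ n → ℚ.+-identityˡ (seq x n))
                       , (λ x → ≃-pointwise λ n → ℚ.+-identityʳ (seq x n))
            }
          ; inverse = (λ x → ≃-pointwise λ n → ℚ.+-inverseˡ (seq x n))
                    , (λ x → ≃-pointwise λ n → ℚ.+-inverseʳ (seq x n))
          ; ⁻¹-cong = -ᵣ-cong
          }
        ; comm = λ x y → ≃-pointwise λ n → ℚ.+-comm (seq x n) (seq y n)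
        }
      ; *-cong = *ᵣ-cong
      ; *-assoc = λ x y z → ≃-pointwise λ n → ℚ.*-assoc (seq x n) (seq y n) (seq z n)
      ; *-identity = (λ x → ≃-pointwise λ n → ℚ.*-identityˡ (seq x n))
                   , (λ x → ≃-pointwise λ n → ℚ.*-identityʳ (seq x n))
      ; distrib = (λ x y z → ≃-pointwise λ n → ℚ.*-distribˡ-+ (seq x n) (seq y n) (seq z n))
                , (λ x y z → ≃-pointwise λ n → ℚ.*-distribʳ-+ (seq x n) (seq y n) (seq z n))
      }
    ; *-comm = *ᵣ-comm
    }
  }

-- Equality of reals cannot be decided, so the ring solver computes with rational coefficients,
-- whose equality it can test.
fromℚ-morphism : CommutativeRing.rawRing ℚ.+-*-commutativeRing
                 -Raw-AlmostCommutative⟶ fromCommutativeRing ℝ-commutativeRing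
fromℚ-morphism = record
  { ⟦_⟧ = fromℚ
  ; +-homo = λ _ _ → ≃-pointwise λ _ → refl
  ; *-homo = λ _ _ → ≃-pointwise λ _ → refl
  ; -‿homo = λ _ → ≃-pointwise λ _ → refl
  ; 0-homo = ≃-refl
  ; 1-homo = ≃-refl
  }

fromℚ-≃? : ∀ a b → Maybe (fromℚ a ≃ fromℚ b)
fromℚ-≃? a b = Maybe.map (λ { refl → ≃-refl }) (dec⇒maybe (a ℚ.≟ b))

module ℝ-Solver = RingSolver (CommutativeRing.rawRing ℚ.+-*-commutativeRing)
  (fromCommutativeRing ℝ-commutativeRing) fromℚ-morphism fromℚ-≃?

open ℝ-Solver using (Polynomial; solve; _:=_; _:+_; _:*_; _:-_; :-_; con)

x≃y⇒x-y≃0 : ∀ {x y} → x ≃ y → x -ᵣ y ≃ 0ᵣ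
x≃y⇒x-y≃0 {x} {y} x≃y = ≃-trans (sub-cong x≃y ≃-refl) (≃-pointwise λ n → ℚ.+-inverseʳ (seq y n))

x-y≃0⇒x≃y : ∀ {x y} → x -ᵣ y ≃ 0ᵣ → x ≃ y
x-y≃0⇒x≃y {x} {y} x-y≃0 = begin
  x              ≈⟨ ≃-pointwise (λ n → sub-add (seq x n) (seq y n)) ⟩
  x -ᵣ y +ᵣ y    ≈⟨ +ᵣ-cong x-y≃0 ≃-refl ⟩
  0ᵣ +ᵣ y        ≈⟨ ≃-pointwise (λ n → ℚ.+-identityˡ (seq y n)) ⟩
  y              ∎

-- Apartness from zero and cancellation

Apart₀ : ℝ → Set
Apart₀ x = ∃[ δ ] (0ℚ ℚ.< δ × ∃[ N ] (∀ n → N ℕ.≤ n → δ ℚ.≤ ∣ seq x n ∣))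

∣a-0∣ : ∀ a → ∣ a ℚ.- 0ℚ ∣ ≡ ∣ a ∣
∣a-0∣ a = cong ∣_∣ (ℚ.+-identityʳ a)

-- Beyond some `N` the terms are within ε/4 of each other. Comparing the rational `∣ seq x N ∣` with
-- ε/2 is decidable: if it is smaller, all later terms stay below ε; otherwise they are all at least
-- ε/4, which is apartness.
¬apart₀⇒≃0 : ∀ {x} → ¬ Apart₀ x → x ≃ 0ᵣ
¬apart₀⇒≃0 {x} ¬apart = mk≃ small
  where
  small : x ≈ 0ᵣ
  small ε 0<ε with cauchy x (½ ℚ.* (½ ℚ.* ε)) (half-pos (half-pos 0<ε))
  ... | N , h with ∣ seq x N ∣ ℚ.<? ½ ℚ.* ε
  ... | yes xN< = N , λ n n≥N → subst (ℚ._< ε)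
    (trans (cong ∣_∣ (sym (sub-add (seq x n) (seq x N)))) (sym (∣a-0∣ (seq x n))))
    (∣+∣<ε (seq x n ℚ.- seq x N) (seq x N)
      (ℚ.<-trans (h n N n≥N ℕ.≤-refl) quarter<half) xN<)
    where
    quarter<half : ½ ℚ.* (½ ℚ.* ε) ℚ.< ½ ℚ.* ε
    quarter<half = subst (½ ℚ.* (½ ℚ.* ε) ℚ.<_) (half+half (½ ℚ.* ε))
      (subst (ℚ._< ½ ℚ.* (½ ℚ.* ε) ℚ.+ ½ ℚ.* (½ ℚ.* ε)) (ℚ.+-identityʳ _)
        (ℚ.+-monoʳ-< (½ ℚ.* (½ ℚ.* ε)) (half-pos (half-pos 0<ε))))
  ... | no xN≮ = contradiction
    (½ ℚ.* (½ ℚ.* ε) , half-pos (half-pos 0<ε) , N , λ n n≥N →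
      ℚ.≮⇒≥ λ xn< → xN≮ (subst (ℚ._< ½ ℚ.* ε)
        (cong ∣_∣ (sym (sub-add (seq x N) (seq x n))))
        (∣+∣<ε (seq x N ℚ.- seq x n) (seq x n) (h N n ℕ.≤-refl n≥N) xn<)))
    ¬apart

apart₀⇒≄0 : ∀ {x} → Apart₀ x → ¬ (x ≃ 0ᵣ)
apart₀⇒≄0 {x} (δ , 0<δ , N , h) (mk≃ x≈0) with x≈0 δ 0<δ
... | M , g = ℚ.<-irrefl refl (ℚ.≤-<-trans (h (M ⊔ N) (ℕ.m≤n⊔m M N))
  (subst (ℚ._< δ) (∣a-0∣ (seq x (M ⊔ N))) (g (M ⊔ N) (ℕ.m≤m⊔n M N))))

≃0-stable : ∀ {x} → ¬ ¬ (x ≃ 0ᵣ) → x ≃ 0ᵣ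
≃0-stable ¬¬x≃0 = ¬apart₀⇒≃0 λ apart → ¬¬x≃0 (apart₀⇒≄0 apart)

apart₀-cancelˡ : ∀ {x y} → Apart₀ x → x *ᵣ y ≃ 0ᵣ → y ≃ 0ᵣ
apart₀-cancelˡ {x} {y} (δ , 0<δ , N , h) (mk≃ xy≈0) = mk≃ small
  where
  instance _ = ℚ.positive 0<δ
  small : y ≈ 0ᵣ
  small ε 0<ε with xy≈0 (δ ℚ.* ε) (subst (ℚ._< δ ℚ.* ε) (ℚ.*-zeroʳ δ) (ℚ.*-monoʳ-<-pos δ 0<ε))
  ... | M , g = M ⊔ N , λ n n≥ → subst (ℚ._< ε) (sym (∣a-0∣ (seq y n)))
    (ℚ.*-cancelˡ-<-nonNeg δ {{ℚ.pos⇒nonNeg δ}}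
      (ℚ.≤-<-trans
        (ℚ.*-monoʳ-≤-nonNeg ∣ seq y n ∣ {{ℚ.∣-∣-nonNeg (seq y n)}} (h n (ℕ.m⊔n≤o⇒n≤o M N n≥)))
        (subst (ℚ._< δ ℚ.* ε) (trans (∣a-0∣ _) (ℚ.∣p*q∣≡∣p∣*∣q∣ (seq x n) (seq y n)))
          (g n (ℕ.m⊔n≤o⇒m≤o M N n≥)))))

-- Division uses `Apart₀ x`, of which `¬ (x ≃ 0ᵣ)` yields only the double negation. This suffices
-- because `y ≃ 0ᵣ` is stable.
*ᵣ-cancelˡ-0 : ∀ {x y} → ¬ (x ≃ 0ᵣ) → x *ᵣ y ≃ 0ᵣ → y ≃ 0ᵣ
*ᵣ-cancelˡ-0 x≄0 xy≃0 = ≃0-stable λ y≄0 → x≄0 (¬apart₀⇒≃0 λ apart → y≄0 (apart₀-cancelˡ apart xy≃0))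

*ᵣ-cancelˡ : ∀ {x y z} → ¬ (x ≃ 0ᵣ) → x *ᵣ y ≃ x *ᵣ z → y ≃ z
*ᵣ-cancelˡ {x} {y} {z} x≄0 xy≃xz = x-y≃0⇒x≃y (*ᵣ-cancelˡ-0 x≄0 (begin
  x *ᵣ (y -ᵣ z)         ≈⟨ solve 3 (λ x y z → x :* (y :- z) := x :* y :- x :* z) ≃-refl x y z ⟩
  x *ᵣ y -ᵣ x *ᵣ z      ≈⟨ x≃y⇒x-y≃0 xy≃xz ⟩
  0ᵣ                    ∎))

1≄0 : ¬ (1ᵣ ≃ 0ᵣ)
1≄0 = apart₀⇒≄0 (1ℚ , ℚ.positive⁻¹ 1ℚ , 0 , λ _ _ → ℚ.≤-refl)

-- Polynomials over ℚ and polynomial functions of a configuration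

constP : ∀ k → ℚ → Poly k
constP zero    c = const c
constP (suc k) c = poly (constP k c ∷ [])

varP : ∀ {k} → Fin k → Poly k
varP {suc k} zero    = poly (constP k 0ℚ ∷ constP k 1ℚ ∷ [])
varP {suc k} (suc i) = poly (varP i ∷ [])

addP  : ∀ {k} → Poly k → Poly k → Poly k
addPs : ∀ {k} → List (Poly k) → List (Poly k) → List (Poly k)
addP (const c) (const d) = const (c ℚ.+ d)
addP (poly cs) (poly ds) = poly (addPs cs ds)
addPs []       ds       = ds
addPs (c ∷ cs) []       = c ∷ cs
addPs (c ∷ cs) (d ∷ ds) = addP c d ∷ addPs cs ds

mulP   : ∀ {k} → Poly k → Poly k → Poly k
mulPs  : ∀ {k} → List (Poly k) → List (Poly k) → List (Poly k)
scaleP : ∀ {k} → Poly k → List (Poly k) → List (Poly k)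
mulP (const c) (const d) = const (c ℚ.* d)
mulP (poly cs) (poly ds) = poly (mulPs cs ds)
mulPs []           ds = []
mulPs {k} (c ∷ cs) ds = addPs (scaleP c ds) (constP k 0ℚ ∷ mulPs cs ds)
scaleP c []       = []
scaleP c (d ∷ ds) = mulP c d ∷ scaleP c ds

eval-constP : ∀ k c (x : Vector ℝ k) → eval (constP k c) x ≃ fromℚ c
eval-constP zero    c x = ≃-refl
eval-constP (suc k) c x = begin
  eval (constP k c) (V.tail x) +ᵣ V.head x *ᵣ 0ᵣ  ≈⟨ +ᵣ-cong (eval-constP k c (V.tail x)) ≃-refl ⟩
  fromℚ c +ᵣ V.head x *ᵣ 0ᵣ                       ≈⟨ solve 2 (λ c x → c :+ x :* con 0ℚ := c) ≃-refl (fromℚ c) (V.head x) ⟩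
  fromℚ c                                         ∎

eval-varP : ∀ {k} (i : Fin k) (x : Vector ℝ k) → eval (varP i) x ≃ x i
eval-varP {suc k} zero x = begin
  eval (constP k 0ℚ) t +ᵣ h *ᵣ (eval (constP k 1ℚ) t +ᵣ h *ᵣ 0ᵣ)
    ≈⟨ +ᵣ-cong (eval-constP k 0ℚ t) (*ᵣ-congˡ (+ᵣ-cong (eval-constP k 1ℚ t) ≃-refl)) ⟩
  0ᵣ +ᵣ h *ᵣ (1ᵣ +ᵣ h *ᵣ 0ᵣ)
    ≈⟨ solve 1 (λ h → con 0ℚ :+ h :* (con 1ℚ :+ h :* con 0ℚ) := h) ≃-refl h ⟩
  h ∎
  where
  h = V.head x
  t = V.tail x
eval-varP (suc i) x = begin
  eval (varP i) (V.tail x) +ᵣ V.head x *ᵣ 0ᵣ  ≈⟨ +ᵣ-cong (eval-varP i (V.tail x)) ≃-refl ⟩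
  x (suc i) +ᵣ V.head x *ᵣ 0ᵣ                 ≈⟨ solve 2 (λ c x → c :+ x :* con 0ℚ := c) ≃-refl (x (suc i)) (V.head x) ⟩
  x (suc i)                                   ∎

eval-addP : ∀ {k} (f g : Poly k) x → eval (addP f g) x ≃ eval f x +ᵣ eval g x
horner-addPs : ∀ {k} (cs ds : List (Poly k)) x → horner (addPs cs ds) x ≃ horner cs x +ᵣ horner ds x
eval-addP (const c) (const d) x = ≃-pointwise λ _ → refl
eval-addP (poly cs) (poly ds) x = horner-addPs cs ds x
horner-addPs [] ds x = solve 1 (λ d → d := con 0ℚ :+ d) ≃-refl (horner ds x)
horner-addPs (c ∷ cs) [] x = solve 1 (λ d → d := d :+ con 0ℚ) ≃-refl (horner (c ∷ cs) x)
horner-addPs (c ∷ cs) (d ∷ ds) x = begin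
  eval (addP c d) t +ᵣ h *ᵣ horner (addPs cs ds) x
    ≈⟨ +ᵣ-cong (eval-addP c d t) (*ᵣ-congˡ (horner-addPs cs ds x)) ⟩
  (eval c t +ᵣ eval d t) +ᵣ h *ᵣ (horner cs x +ᵣ horner ds x)
    ≈⟨ solve 5 (λ c d h cs ds → (c :+ d) :+ h :* (cs :+ ds) := (c :+ h :* cs) :+ (d :+ h :* ds)) ≃-refl
         (eval c t) (eval d t) h (horner cs x) (horner ds x) ⟩
  (eval c t +ᵣ h *ᵣ horner cs x) +ᵣ (eval d t +ᵣ h *ᵣ horner ds x) ∎
  where
  h = V.head x
  t = V.tail x

eval-mulP : ∀ {k} (f g : Poly k) x → eval (mulP f g) x ≃ eval f x *ᵣ eval g x
horner-mulPs : ∀ {k} (cs ds : List (Poly k)) x → horner (mulPs cs ds) x ≃ horner cs x *ᵣ horner ds x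
horner-scaleP : ∀ {k} (c : Poly k) ds x → horner (scaleP c ds) x ≃ eval c (V.tail x) *ᵣ horner ds x
eval-mulP (const c) (const d) x = ≃-pointwise λ _ → refl
eval-mulP (poly cs) (poly ds) x = horner-mulPs cs ds x
horner-mulPs [] ds x = solve 1 (λ d → con 0ℚ := con 0ℚ :* d) ≃-refl (horner ds x)
horner-mulPs {k} (c ∷ cs) ds x = begin
  horner (addPs (scaleP c ds) (constP k 0ℚ ∷ mulPs cs ds)) x
    ≈⟨ horner-addPs (scaleP c ds) _ x ⟩
  horner (scaleP c ds) x +ᵣ (eval (constP k 0ℚ) t +ᵣ h *ᵣ horner (mulPs cs ds) x)
    ≈⟨ +ᵣ-cong (horner-scaleP c ds x) (+ᵣ-cong (eval-constP k 0ℚ t) (*ᵣ-congˡ (horner-mulPs cs ds x))) ⟩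
  eval c t *ᵣ horner ds x +ᵣ (0ᵣ +ᵣ h *ᵣ (horner cs x *ᵣ horner ds x))
    ≈⟨ solve 4 (λ c h cs ds → c :* ds :+ (con 0ℚ :+ h :* (cs :* ds)) := (c :+ h :* cs) :* ds) ≃-refl
         (eval c t) h (horner cs x) (horner ds x) ⟩
  (eval c t +ᵣ h *ᵣ horner cs x) *ᵣ horner ds x ∎
  where
  h = V.head x
  t = V.tail x
horner-scaleP c [] x = solve 1 (λ c → con 0ℚ := c :* con 0ℚ) ≃-refl (eval c (V.tail x))
horner-scaleP c (d ∷ ds) x = begin
  eval (mulP c d) t +ᵣ h *ᵣ horner (scaleP c ds) x
    ≈⟨ +ᵣ-cong (eval-mulP c d t) (*ᵣ-congˡ (horner-scaleP c ds x)) ⟩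
  eval c t *ᵣ eval d t +ᵣ h *ᵣ (eval c t *ᵣ horner ds x)
    ≈⟨ solve 4 (λ c d h ds → c :* d :+ h :* (c :* ds) := c :* (d :+ h :* ds)) ≃-refl
         (eval c t) (eval d t) h (horner ds x) ⟩
  eval c t *ᵣ (eval d t +ᵣ h *ᵣ horner ds x) ∎
  where
  h = V.head x
  t = V.tail x

nonZero-or-vanishing : ∀ {k} (f : Poly k) → NonZeroPoly f ⊎ (∀ x → eval f x ≃ 0ᵣ)
nonZero-or-vanishing (const c) with c ℚ.≟ 0ℚ
... | yes refl = inj₂ λ _ → ≃-refl
... | no c≢0   = inj₁ (const c≢0)
nonZero-or-vanishing (poly []) = inj₂ λ _ → ≃-refl
nonZero-or-vanishing (poly (c ∷ cs)) with nonZero-or-vanishing c | nonZero-or-vanishing (poly cs)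
... | inj₁ c≢0  | _                 = inj₁ (poly (here c≢0))
... | inj₂ _    | inj₁ (poly cs≢0)  = inj₁ (poly (there cs≢0))
... | inj₂ c≃0  | inj₂ cs≃0         = inj₂ λ x → begin
  eval c (V.tail x) +ᵣ V.head x *ᵣ horner cs x  ≈⟨ +ᵣ-cong (c≃0 (V.tail x)) (*ᵣ-congˡ (cs≃0 x)) ⟩
  0ᵣ +ᵣ V.head x *ᵣ 0ᵣ                          ≈⟨ solve 1 (λ h → con 0ℚ :+ h :* con 0ℚ := con 0ℚ) ≃-refl (V.head x) ⟩
  0ᵣ                                            ∎

PolyFn : ∀ {n} → (Config n → ℝ) → Set
PolyFn {n} F = Σ[ f ∈ Poly (n ℕ.* 2) ] (∀ q → eval f (V.concat q) ≃ F q)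

-- A single witness `w` rules out that all coefficients of the polynomial vanish, so algebraic
-- independence applies to it and no coefficient has to be computed.
generic-nonzero : ∀ {n} (p : Config n) {F} → Generic p → PolyFn F →
                  ∀ w → ¬ (F w ≃ 0ᵣ) → ¬ (F p ≃ 0ᵣ)
generic-nonzero p gen (f , f≃F) w Fw≄0 Fp≃0 with nonZero-or-vanishing f
... | inj₁ f≢0 = gen f f≢0 (un≃ (≃-trans (f≃F p) Fp≃0))
... | inj₂ f≃0 = Fw≄0 (≃-trans (≃-sym (f≃F w)) (f≃0 (V.concat w)))

polyFn-const : ∀ {n} c → PolyFn {n} (λ _ → fromℚ c)
polyFn-const {n} c = constP (n ℕ.* 2) c , λ q → eval-constP _ c (V.concat q)

polyFn-coordinate : ∀ {n} (i : Fin n) r → PolyFn (λ q → q i r)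
-- `V.concat` stores coordinate `r` of point `i` at index `combine i r`.
polyFn-coordinate i r = varP (combine i r) , λ q → ≃-trans (eval-varP (combine i r) (V.concat q))
  (≃-reflexive (cong (λ s → q (proj₁ s) (proj₂ s)) (remQuot-combine i r)))
  where
  ≃-reflexive : ∀ {x y} → x ≡ y → x ≃ y
  ≃-reflexive refl = ≃-refl

module _ {n} {F G : Config n → ℝ} where

  polyFn-+ : PolyFn F → PolyFn G → PolyFn (λ q → F q +ᵣ G q)
  polyFn-+ (f , f≃) (g , g≃) = addP f g , λ q →
    ≃-trans (eval-addP f g (V.concat q)) (+ᵣ-cong (f≃ q) (g≃ q))

  polyFn-* : PolyFn F → PolyFn G → PolyFn (λ q → F q *ᵣ G q)
  polyFn-* (f , f≃) (g , g≃) = mulP f g , λ q →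
    ≃-trans (eval-mulP f g (V.concat q)) (*ᵣ-cong (f≃ q) (g≃ q))

  polyFn-resp : (∀ q → F q ≃ G q) → PolyFn F → PolyFn G
  polyFn-resp F≃G (f , f≃) = f , λ q → ≃-trans (f≃ q) (F≃G q)

polyFn-neg : ∀ {n} {F : Config n → ℝ} → PolyFn F → PolyFn (λ q → -ᵣ F q)
polyFn-neg {F = F} F-poly = polyFn-resp (λ q → neg≃ (F q)) (polyFn-* {F = λ _ → fromℚ (ℚ.- 1ℚ)} (polyFn-const (ℚ.- 1ℚ)) F-poly)
  where
  neg≃ : ∀ x → fromℚ (ℚ.- 1ℚ) *ᵣ x ≃ -ᵣ x
  neg≃ = solve 1 (λ x → con (ℚ.- 1ℚ) :* x := :- x) ≃-refl

polyFn-sub : ∀ {n} {F G : Config n → ℝ} → PolyFn F → PolyFn G → PolyFn (λ q → F q -ᵣ G q)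
polyFn-sub F-poly G-poly = polyFn-+ F-poly (polyFn-neg G-poly)

-- Degrees of polynomial functions of one real variable

-- Deg d c F: F is a polynomial function of degree at most d whose coefficient
-- of x^d is c, expressed through divisibility of F x - F r by x - r.
Deg : ℕ → ℝ → (ℝ → ℝ) → Set
Deg zero    c F = ∀ x → F x ≃ c
Deg (suc d) c F = ∀ r → Σ[ G ∈ (ℝ → ℝ) ] (Deg d c G × (∀ x → F x ≃ F r +ᵣ (x -ᵣ r) *ᵣ G x))

deg-resp : ∀ {d c c′ F} → c ≃ c′ → Deg d c F → Deg d c′ F
deg-resp {zero}  c≃c′ F-deg x = ≃-trans (F-deg x) c≃c′
deg-resp {suc d} c≃c′ F-deg r with F-deg r
... | G , G-deg , F≃ = G , deg-resp {d} c≃c′ G-deg , F≃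

deg-+ : ∀ {d c c′ F F′} → Deg d c F → Deg d c′ F′ → Deg d (c +ᵣ c′) (λ x → F x +ᵣ F′ x)
deg-+ {zero}  F-deg F′-deg x = +ᵣ-cong (F-deg x) (F′-deg x)
deg-+ {suc d} {F = F} {F′} F-deg F′-deg r with F-deg r | F′-deg r
... | G , G-deg , F≃ | G′ , G′-deg , F′≃ = _ , deg-+ {d} G-deg G′-deg , λ x →
  ≃-trans (+ᵣ-cong (F≃ x) (F′≃ x))
    (solve 5 (λ f f′ u g g′ → (f :+ u :* g) :+ (f′ :+ u :* g′) := (f :+ f′) :+ u :* (g :+ g′)) ≃-refl
       (F r) (F′ r) (x -ᵣ r) (G x) (G′ x))

deg-scale : ∀ {d c F} k → Deg d c F → Deg d (k *ᵣ c) (λ x → k *ᵣ F x)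
deg-scale {zero}  k F-deg x = *ᵣ-congˡ (F-deg x)
deg-scale {suc d} {F = F} k F-deg r with F-deg r
... | G , G-deg , F≃ = _ , deg-scale {d} k G-deg , λ x →
  ≃-trans (*ᵣ-congˡ (F≃ x))
    (solve 4 (λ k f u g → k :* (f :+ u :* g) := k :* f :+ u :* (k :* g)) ≃-refl k (F r) (x -ᵣ r) (G x))

-- Allowing a zero leading coefficient lets `deg-+` add functions of different degrees.
deg-raise : ∀ {d c F} → Deg d c F → Deg (suc d) 0ᵣ F
deg-raise {zero} {c} {F} F-deg r = (λ _ → 0ᵣ) , (λ _ → ≃-refl) , λ x → begin
  F x                    ≈⟨ ≃-trans (F-deg x) (≃-sym (F-deg r)) ⟩
  F r                    ≈⟨ solve 2 (λ f u → f := f :+ u :* con 0ℚ) ≃-refl (F r) (x -ᵣ r) ⟩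
  F r +ᵣ (x -ᵣ r) *ᵣ 0ᵣ  ∎
deg-raise {suc d} F-deg r with F-deg r
... | G , G-deg , F≃ = G , deg-raise {d} G-deg , F≃

deg-*-linear : ∀ {d c F} k → Deg d c F → Deg (suc d) c (λ x → F x *ᵣ (x +ᵣ k))
deg-*-linear {zero} {c} {F} k F-deg r = F , F-deg , λ x → begin
  F x *ᵣ (x +ᵣ k)
    ≈⟨ solve 4 (λ f x r k → f :* (x :+ k) := f :* (r :+ k) :+ (x :- r) :* f) ≃-refl (F x) x r k ⟩
  F x *ᵣ (r +ᵣ k) +ᵣ (x -ᵣ r) *ᵣ F x
    ≈⟨ +ᵣ-cong (*ᵣ-cong (≃-trans (F-deg x) (≃-sym (F-deg r))) ≃-refl) ≃-refl ⟩
  F r *ᵣ (r +ᵣ k) +ᵣ (x -ᵣ r) *ᵣ F x ∎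
deg-*-linear {suc d} {c} {F} k F-deg r with F-deg r
-- Write `x + k` as `(x - r) + (r + k)`. The first part contributes `F x` to the quotient, the
-- second `(r + k) G x`, whose lower degree leaves the leading coefficient unchanged.
... | G , G-deg , F≃ = (λ x → F x +ᵣ (r +ᵣ k) *ᵣ G x) , quotient-deg , λ x → begin
  F x *ᵣ (x +ᵣ k)
    ≈⟨ solve 4 (λ f x r k → f :* (x :+ k) := f :* (r :+ k) :+ (x :- r) :* f) ≃-refl (F x) x r k ⟩
  F x *ᵣ (r +ᵣ k) +ᵣ (x -ᵣ r) *ᵣ F x
    ≈⟨ +ᵣ-cong (*ᵣ-cong (F≃ x) ≃-refl) ≃-refl ⟩
  (F r +ᵣ (x -ᵣ r) *ᵣ G x) *ᵣ (r +ᵣ k) +ᵣ (x -ᵣ r) *ᵣ F x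
    ≈⟨ solve 5 (λ fr u g v fx → (fr :+ u :* g) :* v :+ u :* fx := fr :* v :+ u :* (fx :+ v :* g)) ≃-refl
         (F r) (x -ᵣ r) (G x) (r +ᵣ k) (F x) ⟩
  F r *ᵣ (r +ᵣ k) +ᵣ (x -ᵣ r) *ᵣ (F x +ᵣ (r +ᵣ k) *ᵣ G x) ∎
  where
  quotient-deg : Deg (suc d) c (λ x → F x +ᵣ (r +ᵣ k) *ᵣ G x)
  quotient-deg = deg-resp {suc d}
    (solve 2 (λ c v → c :+ v :* con 0ℚ := c) ≃-refl c (r +ᵣ k))
    (deg-+ {suc d} F-deg (deg-scale {suc d} (r +ᵣ k) (deg-raise {d} G-deg)))

-- Dividing by `x - t zero` keeps the leading coefficient, and the other roots remain roots of the
-- quotient because `t (suc a) - t zero` cancels. In degree zero the value at the remaining root is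
-- `c`.
too-many-roots : ∀ {d c F} → Deg d c F → (t : Fin (suc d) → ℝ) →
                 (∀ a b → a ≢ b → ¬ (t a ≃ t b)) → (∀ a → F (t a) ≃ 0ᵣ) → c ≃ 0ᵣ
too-many-roots {zero}  F-deg t distinct root = ≃-trans (≃-sym (F-deg (t zero))) (root zero)
too-many-roots {suc d} {F = F} F-deg t distinct root with F-deg (t zero)
... | G , G-deg , F≃ = too-many-roots {d} G-deg (λ a → t (suc a))
  (λ a b a≢b → distinct (suc a) (suc b) λ { refl → a≢b refl })
  (λ a → *ᵣ-cancelˡ-0 {t (suc a) -ᵣ t zero} (λ eq → distinct (suc a) zero (λ ()) (x-y≃0⇒x≃y eq)) (begin
    (t (suc a) -ᵣ t zero) *ᵣ G (t (suc a))
      ≈⟨ solve 2 (λ f u → u := (f :+ u) :- f) ≃-refl (F (t zero)) _ ⟩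
    (F (t zero) +ᵣ (t (suc a) -ᵣ t zero) *ᵣ G (t (suc a))) -ᵣ F (t zero)
      ≈⟨ x≃y⇒x-y≃0 (≃-trans (≃-sym (F≃ (t (suc a)))) (≃-trans (root (suc a)) (≃-sym (root zero)))) ⟩
    0ᵣ ∎))

-- Signed areas

-- The ring solver's copy of `area`. The factors 1 come from the row of ones in `C`, so that `det`
-- and `area` agree by unfolding.
:area : ∀ {n} → (a b c d e f : Polynomial n) → Polynomial n
:area a b c d e f = con 1ℚ :* (c :* f :- e :* d)
                 :- con 1ℚ :* (a :* f :- e :* b)
                 :+ con 1ℚ :* (a :* d :- c :* b)

origin e₁ e₂ : Vector ℝ 2
origin _ = 0ᵣ
e₁ = 1ᵣ V.∷ 0ᵣ V.∷ V.[]
e₂ = 0ᵣ V.∷ 1ᵣ V.∷ V.[]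

-- Unfolding areas of explicit points makes conversion checking explode.
abstract
  area : (u v w : Vector ℝ 2) → ℝ
  area u v w = 1ᵣ *ᵣ (v 0F *ᵣ w 1F -ᵣ w 0F *ᵣ v 1F)
            -ᵣ 1ᵣ *ᵣ (u 0F *ᵣ w 1F -ᵣ w 0F *ᵣ u 1F)
            +ᵣ 1ᵣ *ᵣ (u 0F *ᵣ v 1F -ᵣ v 0F *ᵣ u 1F)

  det≃area : ∀ {n} (σ : Triple n) q → det (C σ q) ≃ area (q (i₁ σ)) (q (i₂ σ)) (q (i₃ σ))
  det≃area σ q = ≃-refl

  area-split : ∀ o u v w → area u v w ≃ area o u v +ᵣ area o v w -ᵣ area o u w
  area-split o u v w = solve 8
    (λ o₀ o₁ u₀ u₁ v₀ v₁ w₀ w₁ → :area u₀ u₁ v₀ v₁ w₀ w₁ :=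
      :area o₀ o₁ u₀ u₁ v₀ v₁ :+ :area o₀ o₁ v₀ v₁ w₀ w₁ :- :area o₀ o₁ u₀ u₁ w₀ w₁)
    ≃-refl (o 0F) (o 1F) (u 0F) (u 1F) (v 0F) (v 1F) (w 0F) (w 1F)

  area-antisym : ∀ o u v → area o u v ≃ -ᵣ area o v u
  area-antisym o u v = solve 6
    (λ o₀ o₁ u₀ u₁ v₀ v₁ → :area o₀ o₁ u₀ u₁ v₀ v₁ := :- :area o₀ o₁ v₀ v₁ u₀ u₁)
    ≃-refl (o 0F) (o 1F) (u 0F) (u 1F) (v 0F) (v 1F)

  area-ouu : ∀ o u → area o u u ≃ 0ᵣ
  area-ouu o u = solve 4 (λ o₀ o₁ u₀ u₁ → :area o₀ o₁ u₀ u₁ u₀ u₁ := con 0ℚ)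
    ≃-refl (o 0F) (o 1F) (u 0F) (u 1F)

  area-oou : ∀ o u → area o o u ≃ 0ᵣ
  area-oou o u = solve 4 (λ o₀ o₁ u₀ u₁ → :area o₀ o₁ o₀ o₁ u₀ u₁ := con 0ℚ)
    ≃-refl (o 0F) (o 1F) (u 0F) (u 1F)

  area-ouo : ∀ o u → area o u o ≃ 0ᵣ
  area-ouo o u = solve 4 (λ o₀ o₁ u₀ u₁ → :area o₀ o₁ u₀ u₁ o₀ o₁ := con 0ℚ)
    ≃-refl (o 0F) (o 1F) (u 0F) (u 1F)

  -- For apexes `o`, `s` and neighbours `u`, `v` on the equator, the right side involves only an
  -- upper and a lower triangle. Hence the increments of `z` are prescribed although `z` is not.
  area-step : ∀ o s u v → area o s v -ᵣ area o s u ≃ area o u v -ᵣ area u v s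
  area-step o s u v = solve 8
    (λ o₀ o₁ s₀ s₁ u₀ u₁ v₀ v₁ → :area o₀ o₁ s₀ s₁ v₀ v₁ :- :area o₀ o₁ s₀ s₁ u₀ u₁ :=
      :area o₀ o₁ u₀ u₁ v₀ v₁ :- :area u₀ u₁ v₀ v₁ s₀ s₁)
    ≃-refl (o 0F) (o 1F) (s 0F) (s 1F) (u 0F) (u 1F) (v 0F) (v 1F)

  -- With brackets and vectors taken from `o`, plane vectors satisfy `[u v] w + [v w] u = [u w] v`;
  -- bracketing this with `s` gives the relation.
  plücker : ∀ o s u v w →
    area o u v *ᵣ area o s w +ᵣ area o v w *ᵣ area o s u ≃ area o u w *ᵣ area o s v
  plücker o s u v w = solve 10
    (λ o₀ o₁ s₀ s₁ u₀ u₁ v₀ v₁ w₀ w₁ →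
      :area o₀ o₁ u₀ u₁ v₀ v₁ :* :area o₀ o₁ s₀ s₁ w₀ w₁ :+
      :area o₀ o₁ v₀ v₁ w₀ w₁ :* :area o₀ o₁ s₀ s₁ u₀ u₁ :=
      :area o₀ o₁ u₀ u₁ w₀ w₁ :* :area o₀ o₁ s₀ s₁ v₀ v₁)
    ≃-refl (o 0F) (o 1F) (s 0F) (s 1F) (u 0F) (u 1F) (v 0F) (v 1F) (w 0F) (w 1F)

  area-unit : area origin e₁ e₂ ≃ 1ᵣ
  area-unit = ≃-pointwise λ _ → refl

  polyFn-area : ∀ {n} (a b c : Fin n) → PolyFn (λ q → area (q a) (q b) (q c))
  polyFn-area {n} a b c = polyFn-+ (polyFn-sub (minor b c) (minor a c)) (minor a b)
    where
    minor : ∀ i k → PolyFn {n} (λ q → 1ᵣ *ᵣ (q i 0F *ᵣ q k 1F -ᵣ q k 0F *ᵣ q i 1F))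
    minor i k = polyFn-* (polyFn-const 1ℚ)
      (polyFn-sub (polyFn-* (polyFn-coordinate i 0F) (polyFn-coordinate k 1F))
                  (polyFn-* (polyFn-coordinate k 0F) (polyFn-coordinate i 1F)))

-- By `plücker` and `area-split` this equals `area u v w *ᵣ area o s v`. In the form chosen, areas
-- containing both `o` and `s` enter only through differences, which the bipyramid prescribes.
plücker-defect : (o s u v w : Vector ℝ 2) → ℝ
plücker-defect o s u v w = area o v w *ᵣ (area o s v -ᵣ area o s u)
                        -ᵣ area o u v *ᵣ (area o s w -ᵣ area o s v)

plücker-defect-cong : ∀ {o o′ s s′ u u′ v v′ w w′} → o ≡ o′ → s ≡ s′ → u ≡ u′ → v ≡ v′ → w ≡ w′ →
                      plücker-defect o s u v w ≃ plücker-defect o′ s′ u′ v′ w′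
plücker-defect-cong refl refl refl refl refl = ≃-refl

plücker-defect-unit : plücker-defect origin e₁ e₁ e₂ origin ≃ 1ᵣ
plücker-defect-unit = begin
  area origin e₂ origin *ᵣ (area origin e₁ e₂ -ᵣ area origin e₁ e₁) -ᵣ
  area origin e₁ e₂ *ᵣ (area origin e₁ origin -ᵣ area origin e₁ e₂)
    ≈⟨ sub-cong (*ᵣ-cong (area-ouo origin e₂) (sub-cong area-unit (area-ouu origin e₁)))
                (*ᵣ-cong area-unit (sub-cong (area-ouo origin e₁) area-unit)) ⟩
  0ᵣ *ᵣ (1ᵣ -ᵣ 0ᵣ) -ᵣ 1ᵣ *ᵣ (0ᵣ -ᵣ 1ᵣ)
    ≈⟨ ≃-pointwise (λ _ → refl) ⟩
  1ᵣ ∎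

congruent-from-brackets : ∀ {n} {q q′ : Config (suc n)} →
  (∀ {a b} → a Fin.< b → area (q zero) (q a) (q b) ≃ area (q′ zero) (q′ a) (q′ b)) →
  Congruent q q′
congruent-from-brackets {q = q} {q′} same σ@(triple a b c a<b b<c) = un≃ (begin
  det (C σ q)
    ≈⟨ det≃area σ q ⟩
  area (q a) (q b) (q c)
    ≈⟨ area-split (q zero) (q a) (q b) (q c) ⟩
  area (q zero) (q a) (q b) +ᵣ area (q zero) (q b) (q c) -ᵣ area (q zero) (q a) (q c)
    ≈⟨ sub-cong (+ᵣ-cong (same a<b) (same b<c)) (same (ℕ.<-trans a<b b<c)) ⟩
  area (q′ zero) (q′ a) (q′ b) +ᵣ area (q′ zero) (q′ b) (q′ c) -ᵣ area (q′ zero) (q′ a) (q′ c)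
    ≈⟨ ≃-sym (area-split (q′ zero) (q′ a) (q′ b) (q′ c)) ⟩
  area (q′ a) (q′ b) (q′ c)
    ≈⟨ ≃-sym (det≃area σ q′) ⟩
  det (C σ q′) ∎)

-- Vertices are addressed by natural numbers, those beyond the last one
-- standing for the last one.
clamp : ∀ {n} → ℕ → Fin (suc n)
clamp {n}     zero    = zero
clamp {zero}  (suc l) = zero
clamp {suc n} (suc l) = suc (clamp l)

toℕ-clamp : ∀ {n l} → l ≤ n → toℕ (clamp {n} l) ≡ l
toℕ-clamp z≤n       = refl
toℕ-clamp (s≤s l≤n) = cong suc (toℕ-clamp l≤n)

clamp-toℕ : ∀ {n} (i : Fin (suc n)) → clamp (toℕ i) ≡ i
clamp-toℕ zero            = refl
clamp-toℕ {suc n} (suc i) = cong suc (clamp-toℕ i)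

-- The paper's vertices 1, 2 + i and n are north, equator i and south.
module Bipyramid (j : ℕ) where

  -- The equator has indices 0 to `2 + j`, and the bound to be shown, `n ∸ 4`, is `1 + j`.
  n : ℕ
  n = 5 ℕ.+ j

  pt : Config n → ℕ → Vector ℝ 2
  pt q l = q (clamp l)

  north south : Config n → Vector ℝ 2
  north q = pt q 0
  south q = pt q (4 ℕ.+ j)

  equator : Config n → ℕ → Vector ℝ 2
  equator q i = pt q (suc i)

  A : Config n → ℕ → ℕ → ℝ
  A q i m = area (north q) (equator q i) (equator q m)

  z : Config n → ℕ → ℝ
  z q i = area (north q) (south q) (equator q i)

  A-plücker : ∀ q i k m → A q i k *ᵣ z q m +ᵣ A q k m *ᵣ z q i ≃ A q i m *ᵣ z q k
  A-plücker q i k m = plücker (north q) (south q) (equator q i) (equator q k) (equator q m)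

  -- Areas prescribed by the bipyramid

  record SameAreas (p q : Config n) : Set where
    field
      upper-same   : ∀ {i} → i ≤ 1 ℕ.+ j → A p i (1 ℕ.+ i) ≃ A q i (1 ℕ.+ i)
      lower-same   : ∀ {i} → i ≤ 1 ℕ.+ j → area (equator p i) (equator p (1 ℕ.+ i)) (south p)
                                         ≃ area (equator q i) (equator q (1 ℕ.+ i)) (south q)
      closing-same : A p 0 (2 ℕ.+ j) ≃ A q 0 (2 ℕ.+ j)

  open SameAreas

  sameAreas-join : ∀ {p q q′} → SameAreas p q → SameAreas p q′ → SameAreas q q′
  sameAreas-join s s′ = record
    { upper-same   = λ h → ≃-trans (≃-sym (upper-same s h)) (upper-same s′ h)
    ; lower-same   = λ h → ≃-trans (≃-sym (lower-same s h)) (lower-same s′ h)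
    ; closing-same = ≃-trans (≃-sym (closing-same s)) (closing-same s′)
    }

  equivalent⇒sameAreas : ∀ {n≥5 p q} → Equivalent (bipyramid n n≥5) p q → SameAreas p q
  equivalent⇒sameAreas {p = p} {q} equiv = record
    { upper-same = λ i≤ → triangle (s≤s z≤n) ℕ.≤-refl (s≤s (s≤s (ℕ.m≤n⇒m≤1+n i≤)))
                       (upper (s≤s (s≤s z≤n)) (s≤s (s≤s i≤)))
    ; lower-same = λ i≤ → triangle ℕ.≤-refl (s≤s (s≤s (s≤s i≤))) ℕ.≤-refl
                       (lower (s≤s (s≤s z≤n)) (s≤s (s≤s i≤)))
    ; closing-same = triangle (s≤s z≤n) (s≤s (s≤s z≤n)) (ℕ.n≤1+n _) upperClose
    }
    where
    triangle : ∀ {a b c} → a < b → b < c → c ≤ 4 ℕ.+ j → BipyramidLabels n (suc a) (suc b) (suc c) →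
               area (pt p a) (pt p b) (pt p c) ≃ area (pt q a) (pt q b) (pt q c)
    triangle {a} {b} {c} a<b b<c c≤ labels =
      ≃-trans (≃-sym (det≃area σ p)) (≃-trans (mk≃ (equiv σ (σ , labels′ , ⊆-refl))) (det≃area σ q))
      where
      ec = toℕ-clamp c≤
      eb = toℕ-clamp (ℕ.≤-trans (ℕ.<⇒≤ b<c) c≤)
      ea = toℕ-clamp (ℕ.≤-trans (ℕ.<⇒≤ (ℕ.<-trans a<b b<c)) c≤)
      σ : Triple n
      σ = triple (clamp a) (clamp b) (clamp c)
            (subst₂ _<_ (sym ea) (sym eb) a<b) (subst₂ _<_ (sym eb) (sym ec) b<c)
      labels′ : BipyramidTriangle σ
      labels′ rewrite ea | eb | ec = labels

  z-step : ∀ {p q} → SameAreas p q → ∀ {i} → i ≤ 1 ℕ.+ j → z p (1 ℕ.+ i) -ᵣ z p i ≃ z q (1 ℕ.+ i) -ᵣ z q i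
  z-step {p} {q} same {i} i≤ = begin
    z p (1 ℕ.+ i) -ᵣ z p i
      ≈⟨ area-step (north p) (south p) (equator p i) (equator p (1 ℕ.+ i)) ⟩
    A p i (1 ℕ.+ i) -ᵣ area (equator p i) (equator p (1 ℕ.+ i)) (south p)
      ≈⟨ sub-cong (upper-same same i≤) (lower-same same i≤) ⟩
    A q i (1 ℕ.+ i) -ᵣ area (equator q i) (equator q (1 ℕ.+ i)) (south q)
      ≈⟨ ≃-sym (area-step (north q) (south q) (equator q i) (equator q (1 ℕ.+ i))) ⟩
    z q (1 ℕ.+ i) -ᵣ z q i ∎

  -- The increments of `z` telescope, so offsets from index 0 can be read off `p`, and `z q 0` alone
  -- fixes the whole sequence of `q`.
  z-shift : ∀ {p q} → SameAreas p q → ∀ {i} → i ≤ 2 ℕ.+ j → z q 0 +ᵣ (z p i -ᵣ z p 0) ≃ z q i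
  z-shift {p} {q} same {zero} _ = solve 2 (λ a b → a :+ (b :- b) := a) ≃-refl (z q 0) (z p 0)
  z-shift {p} {q} same {suc i} (s≤s i≤) = begin
    z q 0 +ᵣ (z p (suc i) -ᵣ z p 0)
      ≈⟨ solve 4 (λ a b c d → a :+ (b :- c) := (a :+ (d :- c)) :+ (b :- d)) ≃-refl
           (z q 0) (z p (suc i)) (z p 0) (z p i) ⟩
    (z q 0 +ᵣ (z p i -ᵣ z p 0)) +ᵣ (z p (suc i) -ᵣ z p i)
      ≈⟨ +ᵣ-cong (z-shift same (ℕ.m≤n⇒m≤1+n i≤)) (z-step same i≤) ⟩
    z q i +ᵣ (z q (suc i) -ᵣ z q i)
      ≈⟨ solve 2 (λ a b → a :+ (b :- a) := b) ≃-refl (z q i) (z q (suc i)) ⟩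
    z q (suc i) ∎

  z-determined : ∀ {q q′} → SameAreas q q′ → z q 0 ≃ z q′ 0 → ∀ {i} → i ≤ 2 ℕ.+ j → z q i ≃ z q′ i
  z-determined {q} {q′} same t≃ {i} i≤ = begin
    z q i                        ≈⟨ solve 2 (λ a b → a := b :+ (a :- b)) ≃-refl (z q i) (z q 0) ⟩
    z q 0 +ᵣ (z q i -ᵣ z q 0)    ≈⟨ +ᵣ-cong t≃ ≃-refl ⟩
    z q′ 0 +ᵣ (z q i -ᵣ z q 0)   ≈⟨ z-shift same i≤ ⟩
    z q′ i                       ∎

  -- Quantities that do not vanish for generic configurations

  obstruction : ℕ → Config n → ℝ
  obstruction i q = plücker-defect (north q) (south q) (equator q i) (equator q (1 ℕ.+ i)) (equator q (2 ℕ.+ i))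

  A-polyFn : ∀ i m → PolyFn (λ q → A q i m)
  A-polyFn i m = polyFn-area (clamp 0) (clamp (suc i)) (clamp (suc m))

  obstruction-polyFn : ∀ i → PolyFn (obstruction i)
  obstruction-polyFn i = polyFn-sub
    (polyFn-* (A-polyFn (1 ℕ.+ i) (2 ℕ.+ i)) (polyFn-sub (z-polyFn (1 ℕ.+ i)) (z-polyFn i)))
    (polyFn-* (A-polyFn i (1 ℕ.+ i)) (polyFn-sub (z-polyFn (2 ℕ.+ i)) (z-polyFn (1 ℕ.+ i))))
    where
    z-polyFn : ∀ i → PolyFn (λ q → z q i)
    z-polyFn i = polyFn-area (clamp 0) (clamp (4 ℕ.+ j)) (clamp (suc i))

  obstruction-same : ∀ {p q} → SameAreas p q → ∀ {i} → i ≤ j → obstruction i p ≃ obstruction i q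
  obstruction-same same i≤ = sub-cong
    (*ᵣ-cong (upper-same same (s≤s i≤)) (z-step same (ℕ.m≤n⇒m≤1+n i≤)))
    (*ᵣ-cong (upper-same same (ℕ.m≤n⇒m≤1+n i≤)) (z-step same (s≤s i≤)))

  obstruction-at-zero : ∀ q i → z q (1 ℕ.+ i) ≃ 0ᵣ → obstruction i q ≃ 0ᵣ
  obstruction-at-zero q i z≃0 = begin
    b *ᵣ (z₁ -ᵣ z₀) -ᵣ a *ᵣ (z₂ -ᵣ z₁)
      ≈⟨ solve 5 (λ a b z₀ z₁ z₂ → b :* (z₁ :- z₀) :- a :* (z₂ :- z₁) := (a :+ b) :* z₁ :- (a :* z₂ :+ b :* z₀))
           ≃-refl a b z₀ z₁ z₂ ⟩
    (a +ᵣ b) *ᵣ z₁ -ᵣ (a *ᵣ z₂ +ᵣ b *ᵣ z₀)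
      ≈⟨ sub-cong ≃-refl (A-plücker q i (1 ℕ.+ i) (2 ℕ.+ i)) ⟩
    (a +ᵣ b) *ᵣ z₁ -ᵣ c *ᵣ z₁
      ≈⟨ sub-cong (*ᵣ-congˡ z≃0) (*ᵣ-congˡ z≃0) ⟩
    (a +ᵣ b) *ᵣ 0ᵣ -ᵣ c *ᵣ 0ᵣ
      ≈⟨ solve 2 (λ c d → d :* con 0ℚ :- c :* con 0ℚ := con 0ℚ) ≃-refl c (a +ᵣ b) ⟩
    0ᵣ ∎
    where
    a = A q i (1 ℕ.+ i)
    b = A q (1 ℕ.+ i) (2 ℕ.+ i)
    c = A q i (2 ℕ.+ i)
    z₀ = z q i
    z₁ = z q (1 ℕ.+ i)
    z₂ = z q (2 ℕ.+ i)

  placed : (ℕ → Vector ℝ 2) → Config n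
  placed w i = w (toℕ i)

  pt-placed : ∀ w {l} → l ≤ 4 ℕ.+ j → pt (placed w) l ≡ w l
  pt-placed w l≤ = cong w (toℕ-clamp l≤)

  obstruction-nonzero : ∀ p → Generic p → ∀ {i} → i ≤ j → ¬ (obstruction i p ≃ 0ᵣ)
  obstruction-nonzero p gen {i} i≤j = generic-nonzero p gen (obstruction-polyFn i) (placed w)
    λ eq → 1≄0 (≃-trans (≃-sym value) eq)
    where
    -- Realises `plücker-defect-unit` with equator vertices `i`, `1 + i`, `2 + i` at `e₁`, `e₂`,
    -- `origin`. South gets the default `e₁`, since its offset from `i` is at least 3 by `i ≤ j`;
    -- truncated subtraction puts the vertices before `i` at `e₁` too.
    b : ℕ → Vector ℝ 2
    b 0 = e₁
    b 1 = e₂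
    b 2 = origin
    b _ = e₁
    w : ℕ → Vector ℝ 2
    w 0       = origin
    w (suc l) = b (l ∸ i)
    at : ∀ {m} → m ℕ.+ i ≤ 3 ℕ.+ j → equator (placed w) (m ℕ.+ i) ≡ b m
    at {m} le = trans (pt-placed w (s≤s le)) (cong b (ℕ.m+n∸n≡m m i))
    south≡ : south (placed w) ≡ e₁
    south≡ = trans (pt-placed w ℕ.≤-refl) (cong b (ℕ.+-∸-assoc 3 i≤j))
    value : obstruction i (placed w) ≃ 1ᵣ
    value = ≃-trans
      (plücker-defect-cong refl south≡ (at {0} (ℕ.m≤n⇒m≤o+n 3 i≤j))
        (at {1} (s≤s (ℕ.m≤n⇒m≤o+n 2 i≤j))) (at {2} (s≤s (s≤s (ℕ.m≤n⇒m≤o+n 1 i≤j)))))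
      plücker-defect-unit

  -- `q` itself may fail to be generic. The obstruction is built from prescribed quantities, so it
  -- has the same nonzero value at `q` as at `p`, while a zero of `z` would make it vanish.
  z-nonzero : ∀ p {q} → Generic p → SameAreas p q → ∀ {i} → i ≤ j → ¬ (z q (1 ℕ.+ i) ≃ 0ᵣ)
  z-nonzero p {q} gen same {i} i≤j z≃0 = obstruction-nonzero p gen i≤j
    (≃-trans (obstruction-same {p} {q} same i≤j) (obstruction-at-zero q i z≃0))

  lead : Config n → ℕ → ℝ
  lead q zero    = A q 0 1
  lead q (suc m) = lead q m +ᵣ A q (1 ℕ.+ m) (2 ℕ.+ m)

  -- The signed area of the equator polygon, fanned from north. The closing edge runs from `2 + j`
  -- back to 0, whence the minus sign.
  equatorArea : Config n → ℝ
  equatorArea q = lead q (1 ℕ.+ j) -ᵣ A q 0 (2 ℕ.+ j)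

  equatorArea-polyFn : PolyFn equatorArea
  equatorArea-polyFn = polyFn-sub (lead-polyFn (1 ℕ.+ j)) (A-polyFn 0 (2 ℕ.+ j))
    where
    lead-polyFn : ∀ m → PolyFn (λ q → lead q m)
    lead-polyFn zero    = A-polyFn 0 1
    lead-polyFn (suc m) = polyFn-+ (lead-polyFn m) (A-polyFn (1 ℕ.+ m) (2 ℕ.+ m))

  equatorArea-nonzero : ∀ p → Generic p → ¬ (equatorArea p ≃ 0ᵣ)
  equatorArea-nonzero p gen = generic-nonzero p gen equatorArea-polyFn (placed w)
    λ eq → 1≄0 (≃-trans (≃-sym value) eq)
    where
    -- Only equator vertices 0 and 1 lie away from north, so the first triangle of the sum is the
    -- only one with nonzero area.
    w : ℕ → Vector ℝ 2
    w 1 = e₁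
    w 2 = e₂
    w _ = origin
    lead≃1 : ∀ m → lead (placed w) m ≃ 1ᵣ
    lead≃1 zero    = area-unit
    lead≃1 (suc m) = begin
      lead (placed w) m +ᵣ A (placed w) (1 ℕ.+ m) (2 ℕ.+ m)
        ≈⟨ +ᵣ-cong (lead≃1 m) (area-ouo origin (equator (placed w) (1 ℕ.+ m))) ⟩
      1ᵣ +ᵣ 0ᵣ
        ≈⟨ ≃-pointwise (λ _ → refl) ⟩
      1ᵣ ∎
    value : equatorArea (placed w) ≃ 1ᵣ
    value = begin
      equatorArea (placed w)  ≈⟨ sub-cong (lead≃1 (1 ℕ.+ j)) (area-ouo origin (equator (placed w) 0)) ⟩
      1ᵣ -ᵣ 0ᵣ                ≈⟨ ≃-pointwise (λ _ → refl) ⟩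
      1ᵣ                      ∎

  -- Recovering all areas from one value of `z`

  A₁-determined : ∀ {q q′} → SameAreas q q′ → z q 0 ≃ z q′ 0 → (∀ {i} → i ≤ j → ¬ (z q (1 ℕ.+ i) ≃ 0ᵣ)) →
                  ∀ m → m ≤ 2 ℕ.+ j → A q 1 m ≃ A q′ 1 m
  A₁-determined {q} {q′} same t≃ z≄0 0 _ = begin
    A q 1 0      ≈⟨ area-antisym (north q) (equator q 1) (equator q 0) ⟩
    -ᵣ A q 0 1   ≈⟨ -ᵣ-cong (upper-same same z≤n) ⟩
    -ᵣ A q′ 0 1  ≈⟨ ≃-sym (area-antisym (north q′) (equator q′ 1) (equator q′ 0)) ⟩
    A q′ 1 0     ∎
  A₁-determined {q} {q′} same t≃ z≄0 1 _ =
    ≃-trans (area-ouu (north q) (equator q 1)) (≃-sym (area-ouu (north q′) (equator q′ 1)))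
  -- Plücker for 1, `1 + m`, `2 + m` gives the next bracket from the preceding one and a prescribed
  -- area, up to the nonzero factor `z q (1 + m)`.
  A₁-determined {q} {q′} same t≃ z≄0 (suc (suc m)) le@(s≤s (s≤s m≤j)) = *ᵣ-cancelˡ (z≄0 m≤j) (begin
    z q (1 ℕ.+ m) *ᵣ A q 1 (2 ℕ.+ m)
      ≈⟨ recursion q ⟩
    A q 1 (1 ℕ.+ m) *ᵣ z q (2 ℕ.+ m) +ᵣ A q (1 ℕ.+ m) (2 ℕ.+ m) *ᵣ z q 1
      ≈⟨ +ᵣ-cong (*ᵣ-cong (A₁-determined same t≃ z≄0 (suc m) le′) (z≃ le))
                 (*ᵣ-cong (upper-same same (s≤s m≤j)) (z≃ (s≤s z≤n))) ⟩
    A q′ 1 (1 ℕ.+ m) *ᵣ z q′ (2 ℕ.+ m) +ᵣ A q′ (1 ℕ.+ m) (2 ℕ.+ m) *ᵣ z q′ 1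
      ≈⟨ ≃-sym (recursion q′) ⟩
    z q′ (1 ℕ.+ m) *ᵣ A q′ 1 (2 ℕ.+ m)
      ≈⟨ *ᵣ-cong (≃-sym (z≃ le′)) ≃-refl ⟩
    z q (1 ℕ.+ m) *ᵣ A q′ 1 (2 ℕ.+ m) ∎)
    where
    le′ : 1 ℕ.+ m ≤ 2 ℕ.+ j
    le′ = s≤s (ℕ.m≤n⇒m≤1+n m≤j)
    z≃ : ∀ {i} → i ≤ 2 ℕ.+ j → z q i ≃ z q′ i
    z≃ = z-determined same t≃
    recursion : ∀ q → z q (1 ℕ.+ m) *ᵣ A q 1 (2 ℕ.+ m) ≃
                A q 1 (1 ℕ.+ m) *ᵣ z q (2 ℕ.+ m) +ᵣ A q (1 ℕ.+ m) (2 ℕ.+ m) *ᵣ z q 1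
    recursion q = ≃-trans (*ᵣ-comm _ _) (≃-sym (A-plücker q 1 (1 ℕ.+ m) (2 ℕ.+ m)))

  congruent-of-same-z : ∀ {q q′} → SameAreas q q′ → z q 0 ≃ z q′ 0 →
    (∀ {i} → i ≤ j → ¬ (z q (1 ℕ.+ i) ≃ 0ᵣ)) → Congruent q q′
  congruent-of-same-z {q} {q′} same t≃ z≄0 = congruent-from-brackets λ {a} {b} a<b →
    subst₂ (λ a b → area (north q) (q a) (q b) ≃ area (north q′) (q′ a) (q′ b))
      (clamp-toℕ a) (clamp-toℕ b) (brackets (toℕ a) (toℕ b) a<b (toℕ≤pred[n] b))
    where
    z≃ : ∀ {i} → i ≤ 2 ℕ.+ j → z q i ≃ z q′ i
    z≃ = z-determined same t≃
    A₁≃ : ∀ m → m ≤ 2 ℕ.+ j → A q 1 m ≃ A q′ 1 m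
    A₁≃ = A₁-determined same t≃ z≄0
    -- Fanning from vertex 1 makes `z q 1` the divisor. Vertex 0 would call for `z q 0`, which `z≄0`
    -- does not cover.
    expand : ∀ q i m → z q 1 *ᵣ A q i m ≃ A q 1 m *ᵣ z q i -ᵣ A q 1 i *ᵣ z q m
    expand q i m = begin
      z q 1 *ᵣ A q i m
        ≈⟨ solve 3 (λ x y c → x :* y := (c :+ y :* x) :- c) ≃-refl (z q 1) (A q i m) (A q 1 i *ᵣ z q m) ⟩
      (A q 1 i *ᵣ z q m +ᵣ A q i m *ᵣ z q 1) -ᵣ A q 1 i *ᵣ z q m
        ≈⟨ sub-cong (A-plücker q 1 i m) ≃-refl ⟩
      A q 1 m *ᵣ z q i -ᵣ A q 1 i *ᵣ z q m ∎
    A≃ : ∀ i m → i ≤ 2 ℕ.+ j → m ≤ 2 ℕ.+ j → A q i m ≃ A q′ i m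
    A≃ i m i≤ m≤ = *ᵣ-cancelˡ (z≄0 z≤n) (begin
      z q 1 *ᵣ A q i m
        ≈⟨ expand q i m ⟩
      A q 1 m *ᵣ z q i -ᵣ A q 1 i *ᵣ z q m
        ≈⟨ sub-cong (*ᵣ-cong (A₁≃ m m≤) (z≃ i≤)) (*ᵣ-cong (A₁≃ i i≤) (z≃ m≤)) ⟩
      A q′ 1 m *ᵣ z q′ i -ᵣ A q′ 1 i *ᵣ z q′ m
        ≈⟨ ≃-sym (expand q′ i m) ⟩
      z q′ 1 *ᵣ A q′ i m
        ≈⟨ *ᵣ-cong (≃-sym (z≃ (s≤s z≤n))) ≃-refl ⟩
      z q 1 *ᵣ A q′ i m ∎)
    brackets : ∀ l m → l < m → m ≤ 4 ℕ.+ j →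
               area (north q) (pt q l) (pt q m) ≃ area (north q′) (pt q′ l) (pt q′ m)
    brackets zero m _ _ = ≃-trans (area-oou (north q) (pt q m)) (≃-sym (area-oou (north q′) (pt q′ m)))
    -- Position `suc m` is south exactly when `m` is `3 + j`; the bracket is then a negated `z`.
    -- Otherwise both vertices lie on the equator.
    brackets (suc i) (suc m) (s≤s i<m) (s≤s m≤) with m ℕ.≟ 3 ℕ.+ j
    ... | no m≢ = A≃ i m (ℕ.≤-trans (ℕ.<⇒≤ i<m) m≤′) m≤′
      where
      m≤′ : m ≤ 2 ℕ.+ j
      m≤′ = ℕ.s≤s⁻¹ (ℕ.≤∧≢⇒< m≤ m≢)
    ... | yes refl = begin
      area (north q) (equator q i) (south q)     ≈⟨ area-antisym (north q) (equator q i) (south q) ⟩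
      -ᵣ z q i                                   ≈⟨ -ᵣ-cong (z≃ (ℕ.s≤s⁻¹ i<m)) ⟩
      -ᵣ z q′ i                                  ≈⟨ ≃-sym (area-antisym (north q′) (equator q′ i) (south q′)) ⟩
      area (north q′) (equator q′ i) (south q′)  ∎

  -- The polynomial equation for `z q 0`

  module _ (p : Config n) where

    -- In terms of zᵢ = Z i t, W m is the product of the zᵢ with 1 ≤ i ≤ m, and Q m the sum
    -- over i ≤ m of A(i,i+1) times the product of the zₗ with l ≤ m + 1 and l ≠ i, i + 1.
    Z W Q : ℕ → ℝ → ℝ
    Z i t = t +ᵣ (z p i -ᵣ z p 0)
    W zero    t = 1ᵣ
    W (suc m) t = W m t *ᵣ Z (suc m) t
    Q zero    t = A p 0 1
    Q (suc m) t = Q m t *ᵣ Z (2 ℕ.+ m) t +ᵣ A p (1 ℕ.+ m) (2 ℕ.+ m) *ᵣ (W m t *ᵣ Z 0 t)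

    -- The cyclic sum over the equator: the closing edge contributes `A p (2 + j) 0`, which is minus
    -- `A p 0 (2 + j)`, times the `z` at 1 to `1 + j`.
    P : ℝ → ℝ
    P t = Q (1 ℕ.+ j) t +ᵣ (-ᵣ A p 0 (2 ℕ.+ j)) *ᵣ W (1 ℕ.+ j) t

    W-deg : ∀ m → Deg m 1ᵣ (W m)
    W-deg zero    = λ _ → ≃-refl
    W-deg (suc m) = deg-*-linear {m} _ (W-deg m)

    -- Each summand of `Q m` is a prescribed area times `m` monic linear factors, so the areas add
    -- up to the leading coefficient.
    Q-deg : ∀ m → Deg m (lead p m) (Q m)
    Q-deg zero    = λ _ → ≃-refl
    Q-deg (suc m) = deg-resp {suc m} {F = Q (suc m)}
      (solve 2 (λ l a → l :+ a :* con 1ℚ := l :+ a) ≃-refl (lead p m) (A p (1 ℕ.+ m) (2 ℕ.+ m)))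
      (deg-+ {suc m} (deg-*-linear {m} _ (Q-deg m))
        (deg-scale {suc m} (A p (1 ℕ.+ m) (2 ℕ.+ m)) (deg-*-linear {m} _ (W-deg m))))

    P-deg : Deg (1 ℕ.+ j) (equatorArea p) P
    P-deg = deg-resp {1 ℕ.+ j} {F = P}
      (solve 2 (λ l a → l :+ (:- a) :* con 1ℚ := l :- a) ≃-refl (lead p (1 ℕ.+ j)) (A p 0 (2 ℕ.+ j)))
      (deg-+ {1 ℕ.+ j} (Q-deg (1 ℕ.+ j)) (deg-scale {1 ℕ.+ j} (-ᵣ A p 0 (2 ℕ.+ j)) (W-deg (1 ℕ.+ j))))

    -- Each further triangle of the fan from vertex 0 costs one Plücker relation: `A q 0 (1 + m)`
    -- and `A q (1 + m) (2 + m)` merge into `A q 0 (2 + m)`, and the factor `z q (1 + m)` this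
    -- releases extends `W m`.
    Q≃AW : ∀ {q} → SameAreas p q → ∀ m → m ≤ 1 ℕ.+ j → Q m (z q 0) ≃ A q 0 (1 ℕ.+ m) *ᵣ W m (z q 0)
    Q≃AW {q} same zero _ = ≃-trans (upper-same same z≤n) (solve 1 (λ a → a := a :* con 1ℚ) ≃-refl (A q 0 1))
    Q≃AW {q} same (suc m) (s≤s m≤j) = begin
      Q m t *ᵣ Z (2 ℕ.+ m) t +ᵣ A p (1 ℕ.+ m) (2 ℕ.+ m) *ᵣ (W m t *ᵣ Z 0 t)
        ≈⟨ +ᵣ-cong (*ᵣ-cong (Q≃AW same m (ℕ.m≤n⇒m≤1+n m≤j)) (z-shift same (s≤s (s≤s m≤j))))
                   (*ᵣ-cong (upper-same same (s≤s m≤j)) (*ᵣ-cong ≃-refl (z-shift same z≤n))) ⟩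
      (A q 0 (1 ℕ.+ m) *ᵣ W m t) *ᵣ z q (2 ℕ.+ m) +ᵣ A q (1 ℕ.+ m) (2 ℕ.+ m) *ᵣ (W m t *ᵣ z q 0)
        ≈⟨ solve 5 (λ a w z b y → (a :* w) :* z :+ b :* (w :* y) := (a :* z :+ b :* y) :* w) ≃-refl
             (A q 0 (1 ℕ.+ m)) (W m t) (z q (2 ℕ.+ m)) (A q (1 ℕ.+ m) (2 ℕ.+ m)) (z q 0) ⟩
      (A q 0 (1 ℕ.+ m) *ᵣ z q (2 ℕ.+ m) +ᵣ A q (1 ℕ.+ m) (2 ℕ.+ m) *ᵣ z q 0) *ᵣ W m t
        ≈⟨ *ᵣ-cong (A-plücker q 0 (1 ℕ.+ m) (2 ℕ.+ m)) ≃-refl ⟩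
      (A q 0 (2 ℕ.+ m) *ᵣ z q (1 ℕ.+ m)) *ᵣ W m t
        ≈⟨ solve 3 (λ a z w → (a :* z) :* w := a :* (w :* z)) ≃-refl (A q 0 (2 ℕ.+ m)) (z q (1 ℕ.+ m)) (W m t) ⟩
      A q 0 (2 ℕ.+ m) *ᵣ (W m t *ᵣ z q (1 ℕ.+ m))
        ≈⟨ *ᵣ-congˡ (*ᵣ-congˡ (≃-sym (z-shift same (s≤s (ℕ.m≤n⇒m≤1+n m≤j))))) ⟩
      A q 0 (2 ℕ.+ m) *ᵣ (W m t *ᵣ Z (1 ℕ.+ m) t) ∎
      where t = z q 0

    P-root : ∀ {q} → SameAreas p q → P (z q 0) ≃ 0ᵣ
    P-root {q} same = begin
      P t
        ≈⟨ +ᵣ-cong (Q≃AW same (1 ℕ.+ j) ℕ.≤-refl) (*ᵣ-cong (-ᵣ-cong (closing-same same)) ≃-refl) ⟩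
      A q 0 (2 ℕ.+ j) *ᵣ W (1 ℕ.+ j) t +ᵣ (-ᵣ A q 0 (2 ℕ.+ j)) *ᵣ W (1 ℕ.+ j) t
        ≈⟨ solve 2 (λ a w → a :* w :+ (:- a) :* w := con 0ℚ) ≃-refl (A q 0 (2 ℕ.+ j)) (W (1 ℕ.+ j) t) ⟩
      0ᵣ ∎
      where t = z q 0

-- Congruence classes as roots of the equation

theorem1p2 : (n : ℕ) (n≥5 : 5 ≤ n) (p : Config n) → Generic p → AtMostCongruenceClasses (n ∸ 4) (bipyramid n n≥5) p
theorem1p2 (suc (suc (suc (suc (suc j))))) n≥5@(s≤s (s≤s (s≤s (s≤s (s≤s z≤n))))) p gen {m} q equiv distinct = ℕ.≮⇒≥ λ j+1<m →
  -- A family with more than `1 + j` members contains `2 + j` of them, whose values of `z` at 0 are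
  -- roots of `P p`. If these are distinct, they exceed the degree bound `1 + j` and force
  -- `equatorArea p` to vanish.
  let q′ : Fin (2 ℕ.+ j) → Config n
      q′ a = q (inject≤ a j+1<m)
      same : ∀ a → SameAreas p (q′ a)
      same a = equivalent⇒sameAreas {n≥5} (equiv (inject≤ a j+1<m))
  in equatorArea-nonzero p gen (too-many-roots {1 ℕ.+ j} (P-deg p) (λ a → z (q′ a) 0)
       -- The roots are distinct, as a common value of `z` at 0 would make two members congruent.
       (λ a b a≢b t≃ → distinct _ _ (λ eq → a≢b (inject≤-injective j+1<m j+1<m a b eq))
         (congruent-of-same-z (sameAreas-join (same a) (same b)) t≃ (z-nonzero p gen (same a))))
       (λ a → P-root p (same a)))
  where open Bipyramid j
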